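{- For each positive integer $\Delta$, there is a constant $c$ such that if $A$ is a rank-$m$ $\Delta$-modular matrix, then the number of distinct rows of $A$ is at most $m^2+c\cdot m$.
   Context: An integer matrix $A$ is $\Delta$-modular if the determinant of each $\mathrm{rank}(A)\times\mathrm{rank}(A)$ submatrix of $A$ has absolute value at most $\Delta$.
   Formalization: The rank m is assumed to be at least 1: for m = 0 the claim fails, since a nonempty zero matrix has rank 0 and one distinct row, while the bound m²+c·m is 0. -}

module Defs where

open import Data.Nat using (ℕ; zero; suc)
open import Data.Integer using (ℤ; +_; _+_; _*_; -_; ∣_∣)
open import Data.Integer.Properties using () renaming (_≟_ to _≟ℤ_)
open import Data.Fin using (Fin; zero; suc; punchIn)
open import Data.Vec using (Vec)
import Data.Vec as Vec
open import Data.Vec.Properties using (≡-dec)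
open import Data.List using (List; length; deduplicate)
import Data.List as List
open import Data.Product using (Σ; _×_)
open import Relation.Nullary using (¬_)
open import Relation.Binary.PropositionalEquality using (_≡_)

Matrix : ℕ → ℕ → Set
Matrix r n = Fin r → Fin n → ℤ

ΣFin : (k : ℕ) → (Fin k → ℤ) → ℤ
ΣFin zero    f = + 0
ΣFin (suc k) f = f zero + ΣFin k (λ i → f (suc i))

det : {k : ℕ} → Matrix k k → ℤ
det {zero}  M = + 1
det {suc k} M = go (suc k) (λ j → M zero j * det (λ i l → M (suc i) (punchIn j l)))
  where
  go : (p : ℕ) → (Fin p → ℤ) → ℤ
  go zero    t = + 0
  go (suc p) t = t zero + - go p (λ j → t (suc j))

-- The family of rows  f 0, ..., f (k-1)  of A is linearly independent
-- (over ℤ, equivalently over ℚ, by clearing denominators).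
RowsIndependent : {r n k : ℕ} → Matrix r n → (Fin k → Fin r) → Set
RowsIndependent {r} {n} {k} A f =
  (c : Fin k → ℤ) →
  ((j : Fin n) → ΣFin k (λ i → c i * A (f i) j) ≡ + 0) →
  (i : Fin k) → c i ≡ + 0

HasRank : {r n : ℕ} → Matrix r n → ℕ → Set
HasRank {r} A m =
  Σ (Fin m → Fin r) (λ f → RowsIndependent A f) ×
  ((g : Fin (suc m) → Fin r) → ¬ RowsIndependent A g)

-- Every m×m submatrix (rows f, columns g) of A has |det| ≤ Δ, where m = rank(A).
-- (Arbitrary maps f, g are allowed: non-injective ones give det 0, and
--  reordering rows/columns does not change |det|.)
DeltaModularOfRank : {r n : ℕ} → ℕ → Matrix r n → ℕ → Set
DeltaModularOfRank {r} {n} Δ A m =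
  (f : Fin m → Fin r) (g : Fin m → Fin n) →
  ∣ det (λ i j → A (f i) (g j)) ∣ Data.Nat.≤ Δ
  where import Data.Nat

distinctRows : {r n : ℕ} → Matrix r n → ℕ
distinctRows {r} {n} A =
  length (deduplicate (≡-dec _≟ℤ_) (List.tabulate (λ i → Vec.tabulate (A i))))

-- Everything happens in an abstract alternating form F that satisfies the Plücker
-- exchange identity (a determinant on the rows of A), with values of size at most Δ;
-- contracting a row e means fixing e as first argument. Let Y be the set of rows that
-- contracting e identifies with another row, i.e. x ∈ Y if x and x + te are both rows.
-- In a circuit of Y modulo e, each replacement of x by x + te changes the determinant
-- by a nonzero integer independent of the others, so circuits of Y have length at most
-- 2Δ, and a greedy extension of circuits shows that Y has only O(rank) members.
-- If moreover all circuits of rows of length at most 2Δ have coefficients ±1, then the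
-- same argument leaves no circuit in Y longer than 2, so up to sign Y is independent and
-- contracting e loses at most 2(rank − 1) + O(1) rows. These losses sum to m² + O(m).
-- Otherwise some set of at most 2Δ independent rows lies in no basis of determinant ±Δ:
-- contracting it loses O(m) rows and lowers Δ, and induction on Δ applies.
module Submission where

open import Defs
open import Data.Empty using (⊥; ⊥-elim)
open import Data.Fin using (Fin; zero; suc; fromℕ<; punchIn)
import Data.Fin.Properties as Finₚ
open import Data.Integer as ℤ using (ℤ; +_; -[1+_]; +[1+_]; 0ℤ; 1ℤ; -1ℤ; _+_; _*_; -_; _-_; ∣_∣)
import Data.Integer.Properties as ℤₚ
open import Data.Integer.Tactic.RingSolver using (solve-∀)
open import Data.List using (List; []; _∷_; _++_; length; map; [_]; filter; lookup; tabulate; deduplicate)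
import Data.List.Properties as Listₚ
open import Data.List.Membership.Propositional using (_∈_)
open import Data.List.Membership.Propositional.Properties
  using (∈-lookup; ∈-∃++; ∈-tabulate⁺; ∈-tabulate⁻; ∈-deduplicate⁻)
open import Data.List.Relation.Binary.Permutation.Propositional
  using (_↭_; ↭-sym; ↭-trans; ↭-refl; ↭-reflexive) renaming (refl to ↭r; prep to ↭p; swap to ↭s; trans to ↭t)
open import Data.List.Relation.Binary.Permutation.Propositional.Properties
  using (shift; ↭-length; All-resp-↭; ++⁺ˡ)
open import Data.List.Relation.Binary.Pointwise using (Pointwise; []; _∷_; Pointwise-length)
open import Data.List.Relation.Binary.Sublist.Propositional using (_⊆_; []; _∷_; _∷ʳ_; ⊆-trans)
open import Data.List.Relation.Binary.Sublist.Propositional.Properties using (All-resp-⊆; filter-⊆)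
open import Data.List.Relation.Unary.All using (All; []; _∷_)
import Data.List.Relation.Unary.All as All
import Data.List.Relation.Unary.All.Properties as Allₚ
open import Data.List.Relation.Unary.AllPairs using (AllPairs; []; _∷_)
import Data.List.Relation.Unary.AllPairs as AllPairs
import Data.List.Relation.Unary.AllPairs.Properties as AllPairsₚ
open import Data.List.Relation.Unary.Any using (Any; there; any?)
import Data.List.Relation.Unary.Any as Any
open import Data.List.Relation.Unary.Unique.DecPropositional.Properties using (deduplicate-!)
open import Data.List.Relation.Unary.Unique.Propositional using (Unique)
open import Data.Nat as ℕ using (ℕ; zero; suc; pred; _≤_; _<_; z≤n; s≤s)
import Data.Nat.Properties as ℕₚ
open import Data.Nat.Tactic.RingSolver using () renaming (solve-∀ to ℕsolve-∀)
open import Data.Product using (Σ; ∃; _×_; _,_; proj₁; proj₂)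
open import Data.Sum using (_⊎_; inj₁; inj₂)
import Data.Sum as Sum
open import Data.Unit using (⊤; tt)
open import Data.Vec using (Vec)
import Data.Vec as Vec
import Data.Vec.Functional as Functional
import Data.Vec.Properties as Vecₚ
open import Function using (_∘_)
open import Relation.Binary.Definitions using (tri<; tri≈; tri>)
open import Relation.Binary.PropositionalEquality hiding ([_])
open import Relation.Nullary using (¬_; Dec; yes; no)
open import Relation.Nullary.Decidable using (¬?; decidable-stable)

-- Alternating forms with the Plücker identity

-- Forms replace matrices because projecting along a row makes the other entries rational, and
-- clearing denominators spoils the bound Δ; fixing an argument of a determinant keeps its values
-- integers with the same bound. The obstacle is the leading coefficient. Losing O(rank) rows in
-- each contraction, with a constant depending on Δ, would only give O(m²). The coefficient 1 needs
-- a loss of 2q + O(1) on passing to rank q, and this is available only while the relevant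
-- coefficients are ±1. A coefficient other than ±1 means that two sets of rows differing in one
-- element have determinants which, over all completions, stand in a fixed ratio other than ±1; the
-- set with the smaller ones never reaches Δ. Contracting that set is wasteful, but it happens at
-- most Δ times, so a loss of O(m) rows is harmless there.

exchange : {E : Set} → (List E → ℤ) → (E → ℤ) → List E → E → ℤ
exchange f g []       w = 0ℤ
exchange f g (z ∷ zs) w = f (w ∷ zs) * g z + exchange (f ∘ (z ∷_)) g zs w

-- `val` behaves like the determinant of a list of rows. `plücker` is Cramer's rule: it expands `w`
-- in the basis `z`, the coefficient of an entry being, up to the factor `val z`, the value of `z`
-- with that entry replaced by `w`. Lists of every length are allowed, so contraction needs no
-- change of type; `Ranked` later fixes the one length at which values may be nonzero.
record Form (E : Set) : Set where
  field
    val     : List E → ℤ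
    swap    : ∀ p x y s → val (p ++ x ∷ y ∷ s) ≡ - val (p ++ y ∷ x ∷ s)
    plücker : ∀ z w u → val z * val (w ∷ u) ≡ exchange val (λ x → val (x ∷ u)) z w

open Form

i≡-i⇒i≡0 : ∀ i → i ≡ - i → i ≡ 0ℤ
i≡-i⇒i≡0 (+ zero)    _  = refl
i≡-i⇒i≡0 +[1+ n ]    ()
i≡-i⇒i≡0 -[1+ n ]    ()

*-cancelˡ-≢0 : ∀ {d i j} → d ≢ 0ℤ → d * i ≡ d * j → i ≡ j
*-cancelˡ-≢0 {d} {i} {j} d≢0 = ℤₚ.*-cancelˡ-≡ d i j {{ℤ.≢-nonZero d≢0}}

*-≢0 : ∀ {i j} → i ≢ 0ℤ → j ≢ 0ℤ → i * j ≢ 0ℤ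
*-≢0 {i} i≢0 j≢0 eq with ℤₚ.i*j≡0⇒i≡0∨j≡0 i eq
... | inj₁ p = i≢0 p
... | inj₂ p = j≢0 p

∣∣-≢0 : ∀ {i j} → ∣ i ∣ ≡ ∣ j ∣ → i ≢ 0ℤ → j ≢ 0ℤ
∣∣-≢0 eq i≢0 refl = i≢0 (ℤₚ.∣i∣≡0⇒i≡0 eq)

module _ {E : Set} where

  exchange-neg : ∀ (f : List E → ℤ) {g h : E → ℤ} → (∀ x → g x ≡ - h x) →
                 ∀ z w → exchange f g z w ≡ - exchange f h z w
  exchange-neg f g≡-h []       w = refl
  exchange-neg f {g} {h} g≡-h (z ∷ zs) w
    rewrite g≡-h z | exchange-neg (f ∘ (z ∷_)) {g} {h} g≡-h zs w = lemma (f (w ∷ zs)) (h z) _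
    where
    lemma : ∀ a b c → a * - b + - c ≡ - (a * b + c)
    lemma = solve-∀

  repeat : ∀ (F : Form E) x s → val F (x ∷ x ∷ s) ≡ 0ℤ
  repeat F x s = i≡-i⇒i≡0 _ (swap F [] x x s)

  _/_ : Form E → E → Form E
  val     (F / e) l = val F (e ∷ l)
  swap    (F / e) p = swap F (e ∷ p)
  -- The identity for `F` is applied to `e ∷ z`. The swap puts `w` in front, and the term that
  -- exchanges `e` itself repeats `e` in its second factor.
  plücker (F / e) z w u = begin
    val F (e ∷ z) * val F (e ∷ w ∷ u)     ≡⟨ cong (val F (e ∷ z) *_) (swap F [] e w u) ⟩
    val F (e ∷ z) * - val F (w ∷ e ∷ u)   ≡⟨ ℤₚ.neg-distribʳ-* (val F (e ∷ z)) _ ⟨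
    - (val F (e ∷ z) * val F (w ∷ e ∷ u)) ≡⟨ cong -_ (plücker F (e ∷ z) w (e ∷ u)) ⟩
    - (val F (w ∷ z) * val F (e ∷ e ∷ u) + X)
      ≡⟨ cong (λ t → - (val F (w ∷ z) * t + X)) (repeat F e u) ⟩
    - (val F (w ∷ z) * 0ℤ + X)            ≡⟨ cong (λ t → - (t + X)) (ℤₚ.*-zeroʳ (val F (w ∷ z))) ⟩
    - (0ℤ + X)                            ≡⟨ cong -_ (ℤₚ.+-identityˡ X) ⟩
    - X                                   ≡⟨ exchange-neg _ (λ x → swap F [] e x u) z w ⟨
    exchange (val F ∘ (e ∷_)) (λ x → val F (e ∷ x ∷ u)) z w ∎
    where
    open ≡-Reasoning
    X = exchange (val F ∘ (e ∷_)) (λ x → val F (x ∷ e ∷ u)) z w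

  infixl 6 _/_ _⫽_
  infix 4 _⊢_~_

  _⫽_ : Form E → List E → Form E
  F ⫽ []      = F
  F ⫽ (s ∷ S) = (F / s) ⫽ S

  val-⫽ : ∀ F S l → val (F ⫽ S) l ≡ val F (S ++ l)
  val-⫽ F []      l = refl
  val-⫽ F (s ∷ S) l = val-⫽ (F / s) S l

  ∣val∣-↭ : ∀ F {l l′} → l ↭ l′ → ∣ val F l ∣ ≡ ∣ val F l′ ∣
  ∣val∣-↭ F ↭r         = refl
  ∣val∣-↭ F (↭p x p)   = ∣val∣-↭ (F / x) p
  ∣val∣-↭ F (↭s {xs} {ys} x y p) =
    trans (cong ∣_∣ (swap F [] x y xs)) (trans (ℤₚ.∣-i∣≡∣i∣ (val F (y ∷ x ∷ xs))) (∣val∣-↭ (F / y / x) p))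
  ∣val∣-↭ F (↭t p q)   = trans (∣val∣-↭ F p) (∣val∣-↭ F q)

  val≢0-↭ : ∀ F {l l′} → l ↭ l′ → val F l ≢ 0ℤ → val F l′ ≢ 0ℤ
  val≢0-↭ F p = ∣∣-≢0 (∣val∣-↭ F p)

  val≡0-↭ : ∀ F {l l′} → l ↭ l′ → val F l ≡ 0ℤ → val F l′ ≡ 0ℤ
  val≡0-↭ F p eq = ℤₚ.∣i∣≡0⇒i≡0 (trans (sym (∣val∣-↭ F p)) (cong ∣_∣ eq))

  -- For rows of a matrix: `x` vanishes modulo what has been contracted, so for `F ⫽ S` with `S`
  -- independent it lies in the span of `S`.
  Null : Form E → E → Set
  Null F x = ∀ u → val F (x ∷ u) ≡ 0ℤ

  Multiple : ℤ → Form E → E → E → Set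
  Multiple c F x y = ∀ u → val F (x ∷ u) ≡ c * val F (y ∷ u)

  _⊢_~_ : Form E → E → E → Set
  F ⊢ x ~ y = ∀ u → val F (x ∷ u) ≡ val F (y ∷ u)

  ~-sym : ∀ {F x y} → F ⊢ x ~ y → F ⊢ y ~ x
  ~-sym x~y u = sym (x~y u)

  ~-trans : ∀ {F x y z} → F ⊢ x ~ y → F ⊢ y ~ z → F ⊢ x ~ z
  ~-trans x~y y~z u = trans (x~y u) (y~z u)

  null-~ : ∀ {F x y} → Null F x → Null F y → F ⊢ x ~ y
  null-~ nx ny u = trans (nx u) (sym (ny u))

  null-/ : ∀ F {x} → Null F x → ∀ e → Null (F / e) x
  null-/ F {x} n e u = trans (swap F [] e x u) (cong -_ (n (e ∷ u)))

  ~-/ : ∀ F {x y} → F ⊢ x ~ y → ∀ e → F / e ⊢ x ~ y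
  ~-/ F {x} {y} x~y e u = trans (swap F [] e x u) (trans (cong -_ (x~y (e ∷ u))) (sym (swap F [] e y u)))

  ~-swap : ∀ F {e f x y} → F / e / f ⊢ x ~ y → F / f / e ⊢ x ~ y
  ~-swap F {e} {f} {x} {y} x~y u = trans (swap F [] f e _) (trans (cong -_ (x~y u)) (sym (swap F [] f e _)))

  null-⫽ : ∀ F S {x} → (∀ u → val F (S ++ x ∷ u) ≡ 0ℤ) → Null (F ⫽ S) x
  null-⫽ F S n u = trans (val-⫽ F S _) (n u)

  ⫽-null : ∀ F S {x} → Null (F ⫽ S) x → ∀ u → val F (S ++ x ∷ u) ≡ 0ℤ
  ⫽-null F S n u = trans (sym (val-⫽ F S _)) (n u)

  exchange-null : ∀ F {x} → Null F x → ∀ g z → exchange (val F) g z x ≡ 0ℤ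
  exchange-null F n g []       = refl
  exchange-null F n g (z ∷ zs) = cong₂ (λ a b → a * g z + b) (n zs) (exchange-null (F / z) (null-/ F n z) g zs)

  exchange-~ : ∀ F {x y} → F ⊢ x ~ y → ∀ g z → exchange (val F) g z x ≡ exchange (val F) g z y
  exchange-~ F x~y g []       = refl
  exchange-~ F x~y g (z ∷ zs) = cong₂ (λ a b → a * g z + b) (x~y zs) (exchange-~ (F / z) (~-/ F x~y z) g zs)

  -- If x is a multiple of e in F, then the factor can be read off against any z.
  cramer : ∀ F {e x} → Null (F / e) x → ∀ z u → val F (e ∷ z) * val F (x ∷ u) ≡ val F (x ∷ z) * val F (e ∷ u)
  cramer F {e} {x} n z u = trans (plücker F (e ∷ z) x u)
    (trans (cong (λ t → val F (x ∷ z) * val F (e ∷ u) + t) (exchange-null (F / e) n _ z)) (ℤₚ.+-identityʳ _))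

  cramer-difference : ∀ F {e x y} → F / e ⊢ x ~ y → ∀ z u →
    val F (e ∷ z) * (val F (y ∷ u) - val F (x ∷ u)) ≡ (val F (y ∷ z) - val F (x ∷ z)) * val F (e ∷ u)
  cramer-difference F {e} {x} {y} x~y z u = begin
    d * (val F (y ∷ u) - val F (x ∷ u))                        ≡⟨ distrib d _ _ ⟩
    d * val F (y ∷ u) - d * val F (x ∷ u)                      ≡⟨ cong₂ _-_ (plücker F (e ∷ z) y u) (plücker F (e ∷ z) x u) ⟩
    (b * c + ex y) - (a * c + ex x)                            ≡⟨ cong (λ t → (b * c + t) - (a * c + ex x)) (exchange-~ (F / e) x~y _ z) ⟨
    (b * c + ex x) - (a * c + ex x)                            ≡⟨ collect a b c (ex x) ⟩
    (b - a) * c                                                ∎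
    where
    open ≡-Reasoning
    d = val F (e ∷ z)
    a = val F (x ∷ z)
    b = val F (y ∷ z)
    c = val F (e ∷ u)
    ex : E → ℤ
    ex = exchange (val F ∘ (e ∷_)) (λ w → val F (w ∷ u)) z
    distrib : ∀ p q r → p * (q - r) ≡ p * q - p * r
    distrib = solve-∀
    collect : ∀ a b c t → (b * c + t) - (a * c + t) ≡ (b - a) * c
    collect = solve-∀

  -- Only the lists obtained from `b` by omitting one entry need testing. The values there are the
  -- coordinates of `x` and `y` in the basis `b`, up to `val F b`, and `multiple?` recovers all
  -- other values from them by `plücker`.
  separate : ∀ c F x y b →
    (∀ g → exchange (val F) g b x ≡ c * exchange (val F) g b y) ⊎ ∃ λ u → val F (x ∷ u) ≢ c * val F (y ∷ u)
  separate c F x y []       = inj₁ λ g → sym (ℤₚ.*-zeroʳ c)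
  separate c F x y (z ∷ zs) with val F (x ∷ zs) ℤₚ.≟ c * val F (y ∷ zs)
  ... | no  ≢ = inj₂ (zs , ≢)
  ... | yes p with separate c (F / z) x y zs
  ... | inj₁ q = inj₁ λ g → trans (cong₂ (λ a b → a * g z + b) p (q g)) (lemma c _ (g z) _)
    where
    lemma : ∀ c a g e → c * a * g + c * e ≡ c * (a * g + e)
    lemma = solve-∀
  ... | inj₂ (u , ≢) = inj₂ (z ∷ u , λ p → ≢ (begin
    val F (z ∷ x ∷ u)           ≡⟨ swap F [] z x u ⟩
    - val F (x ∷ z ∷ u)         ≡⟨ cong -_ p ⟩
    - (c * val F (y ∷ z ∷ u))   ≡⟨ ℤₚ.neg-distribʳ-* c _ ⟩
    c * - val F (y ∷ z ∷ u)     ≡⟨ cong (c *_) (swap F [] z y u) ⟨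
    c * val F (z ∷ y ∷ u)       ∎))
    where open ≡-Reasoning

  multiple? : ∀ c F {b} → val F b ≢ 0ℤ → ∀ x y → Multiple c F x y ⊎ ∃ λ u → val F (x ∷ u) ≢ c * val F (y ∷ u)
  multiple? c F {b} b≢0 x y with separate c F x y b
  ... | inj₂ p = inj₂ p
  ... | inj₁ p = inj₁ λ u → *-cancelˡ-≢0 b≢0 (begin
    val F b * val F (x ∷ u)                       ≡⟨ plücker F b x u ⟩
    exchange (val F) (λ z → val F (z ∷ u)) b x     ≡⟨ p _ ⟩
    c * exchange (val F) (λ z → val F (z ∷ u)) b y ≡⟨ cong (c *_) (plücker F b y u) ⟨
    c * (val F b * val F (y ∷ u))                  ≡⟨ lemma c (val F b) _ ⟩
    val F b * (c * val F (y ∷ u))                  ∎)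
    where
    open ≡-Reasoning
    lemma : ∀ c b v → c * (b * v) ≡ b * (c * v)
    lemma = solve-∀

  null? : ∀ F {b} → val F b ≢ 0ℤ → ∀ x → Null F x ⊎ ∃ λ u → val F (x ∷ u) ≢ 0ℤ
  null? F b≢0 x with multiple? 0ℤ F b≢0 x x
  ... | inj₁ m       = inj₁ m
  ... | inj₂ (u , ≢) = inj₂ (u , ≢)

  ~? : ∀ F {b} → val F b ≢ 0ℤ → ∀ x y → Dec (F ⊢ x ~ y)
  ~? F b≢0 x y with multiple? 1ℤ F b≢0 x y
  ... | inj₁ m       = yes λ u → trans (m u) (ℤₚ.*-identityˡ _)
  ... | inj₂ (u , ≢) = no λ x~y → ≢ (trans (x~y u) (sym (ℤₚ.*-identityˡ _)))

-- Counting inequivalent elements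

module _ {E : Set} where

  -- Bounds a number of classes without forming a quotient and without assuming `E` finite.
  AtMost : (E → E → Set) → (E → Set) → ℕ → Set
  AtMost R P n = ∀ l → AllPairs (λ x y → ¬ R x y) l → All P l → length l ≤ n

  length-filter : ∀ {P : E → Set} (P? : ∀ x → Dec (P x)) l →
                  length l ≡ length (filter P? l) ℕ.+ length (filter (¬? ∘ P?) l)
  length-filter P? []      = refl
  length-filter P? (x ∷ l) with P? x
  ... | yes _ = cong suc (length-filter P? l)
  ... | no  _ = trans (cong suc (length-filter P? l)) (sym (ℕₚ.+-suc (length (filter P? l)) _))

  module _ {R R′ : E → E → Set} (R′? : ∀ x y → Dec (R′ x y)) (R′-refl : ∀ x → R′ x x)
           {P : E → Set} {k : ℕ} (fibre : ∀ x → AtMost R (R′ x) k) where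

    -- Greedy choice: keep the head, discard its whole fibre, continue. The bound `n` makes the
    -- recursion on a filtered list structural.
    representatives : ∀ n l → length l ≤ n → AllPairs (λ x y → ¬ R x y) l →
      ∃ λ r → r ⊆ l × AllPairs (λ x y → ¬ R′ x y) r × length l ≤ length r ℕ.* k
    representatives n       []      _         _          = [] , [] , [] , z≤n
    representatives (suc n) (x ∷ l) (s≤s l≤n) (x≁ ∷ ≁l)
      with representatives n (filter (¬? ∘ R′? x) l) (ℕₚ.≤-trans (Listₚ.length-filter _ l) l≤n) (AllPairsₚ.filter⁺ _ ≁l)
    ... | r , r⊆ , ≁r , bound =
      x ∷ r , refl ∷ ⊆-trans r⊆ (filter-⊆ _ l) , All-resp-⊆ r⊆ (Allₚ.all-filter _ l) ∷ ≁r , (begin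
        suc (length l)                         ≡⟨ cong suc (length-filter (R′? x) l) ⟩
        length (x ∷ filter (R′? x) l) ℕ.+ length (filter (¬? ∘ R′? x) l)
          ≤⟨ ℕₚ.+-mono-≤ (fibre x (x ∷ filter (R′? x) l) (Allₚ.filter⁺ _ x≁ ∷ AllPairsₚ.filter⁺ _ ≁l)
                            (R′-refl x ∷ Allₚ.all-filter _ l)) bound ⟩
        k ℕ.+ length r ℕ.* k                   ∎)
      where open ℕₚ.≤-Reasoning

    atMost-fibres : ∀ {n} → AtMost R′ P n → AtMost R P (n ℕ.* k)
    atMost-fibres am l ≁l pl with representatives (length l) l ℕₚ.≤-refl ≁l
    ... | r , r⊆ , ≁r , bound = ℕₚ.≤-trans bound (ℕₚ.*-monoˡ-≤ k (am r ≁r (All-resp-⊆ r⊆ pl)))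

  atMost-one : ∀ {R : E → E → Set} {P : E → Set} → (∀ {x y} → P x → P y → R x y) → AtMost R P 1
  atMost-one all []          _               _               = z≤n
  atMost-one all (x ∷ [])    _               _               = s≤s z≤n
  atMost-one all (x ∷ y ∷ l) ((x≁y ∷ _) ∷ _) (px ∷ py ∷ _)   = ⊥-elim (x≁y (all px py))

  -- Meant for `R` equality after a contraction and `S` inequality before it: `first` holds one
  -- representative of each contracted class, and `second` holds the rows that the contraction
  -- loses.
  record Split (R S : E → E → Set) (l : List E) : Set where
    field
      first second  : List E
      perm          : l ↭ first ++ second
      first-distinct : AllPairs (λ x y → ¬ R x y) first
      second-S      : AllPairs S second
      related       : All (λ y → Any (R y) first) second
      cross-S       : All (λ y → All (S y) first) second

    length-split : length l ≡ length first ℕ.+ length second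
    length-split = trans (↭-length perm) (Listₚ.length-++ first)

    all-first : {P : E → Set} → All P l → All P first
    all-first pl = Allₚ.++⁻ˡ first (All-resp-↭ perm pl)

    all-second : {P : E → Set} → All P l → All P second
    all-second pl = Allₚ.++⁻ʳ first (All-resp-↭ perm pl)

  split : ∀ {R S : E → E → Set} → (∀ x y → Dec (R x y)) → (∀ {x y} → S x y → S y x) →
          ∀ l → AllPairs S l → Split R S l
  split R? S-sym []      []        = record
    { first = [] ; second = [] ; perm = ↭-refl ; first-distinct = [] ; second-S = [] ; related = [] ; cross-S = [] }
  split R? S-sym (x ∷ l) (sx ∷ sl) = helper (any? (R? x) first)
    where
    rec = split R? S-sym l sl
    open Split rec
    helper : Dec (Any _ first) → Split _ _ (x ∷ l)
    helper (yes p) = record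
      { first = first ; second = x ∷ second
      ; perm = ↭-trans (↭p x perm) (↭-sym (shift x first second))
      ; first-distinct = first-distinct
      ; second-S = all-second sx ∷ second-S
      ; related = p ∷ related
      ; cross-S = all-first sx ∷ cross-S }
    helper (no ¬p) = record
      { first = x ∷ first ; second = second
      ; perm = ↭p x perm
      ; first-distinct = Allₚ.¬Any⇒All¬ first ¬p ∷ first-distinct
      ; second-S = second-S
      ; related = All.map there related
      ; cross-S = All.zipWith (λ { (s , ss) → S-sym s ∷ ss }) (all-second sx , cross-S) }

  lookup-injective : ∀ {B : Set} (f : E → B) {l} → AllPairs (λ x y → f x ≢ f y) l →
                     ∀ i j → f (lookup l i) ≡ f (lookup l j) → i ≡ j
  lookup-injective f (x≢ ∷ ≢l) zero    zero    eq = refl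
  lookup-injective f (x≢ ∷ ≢l) zero    (suc j) eq = ⊥-elim (All.lookup x≢ (∈-lookup j) eq)
  lookup-injective f (x≢ ∷ ≢l) (suc i) zero    eq = ⊥-elim (All.lookup x≢ (∈-lookup i) (sym eq))
  lookup-injective f (x≢ ∷ ≢l) (suc i) (suc j) eq = cong suc (lookup-injective f ≢l i j eq)

  encode-length : ∀ {n} (f : E → Fin n) l → AllPairs (λ x y → f x ≢ f y) l → length l ≤ n
  encode-length f l ≢l = Finₚ.injective⇒≤ λ {i} {j} → lookup-injective f ≢l i j

  Bounded : Form E → ℕ → Set
  Bounded F Δ = ∀ l → ∣ val F l ∣ ≤ Δ

  bounded-/ : ∀ F {Δ} → Bounded F Δ → ∀ e → Bounded (F / e) Δ
  bounded-/ F bnd e l = bnd (e ∷ l)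

  bounded-⫽ : ∀ F S {Δ} → (∀ l → ∣ val F (S ++ l) ∣ ≤ Δ) → Bounded (F ⫽ S) Δ
  bounded-⫽ F S bnd l = subst (λ t → ∣ t ∣ ≤ _) (sym (val-⫽ F S l)) (bnd l)

-- The number of integers in [-Δ, Δ]; `code` numbers them, with the negative ones placed above Δ.
span-count : ℕ → ℕ
span-count Δ = suc (Δ ℕ.+ Δ)

code : ℕ → ℤ → ℕ
code Δ (+ n)    = n
code Δ -[1+ n ] = Δ ℕ.+ suc n

code-< : ∀ Δ i → ∣ i ∣ ≤ Δ → code Δ i < span-count Δ
code-< Δ (+ n)    p = s≤s (ℕₚ.≤-trans p (ℕₚ.m≤m+n Δ Δ))
code-< Δ -[1+ n ] p = s≤s (ℕₚ.+-monoʳ-≤ Δ p)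

code-injective : ∀ Δ i j → ∣ i ∣ ≤ Δ → ∣ j ∣ ≤ Δ → code Δ i ≡ code Δ j → i ≡ j
code-injective Δ (+ m)    (+ n)    _ _ eq = cong +_ eq
code-injective Δ (+ m)    -[1+ n ] p _ eq = ⊥-elim (ℕₚ.m+1+n≰m Δ (subst (_≤ Δ) eq p))
code-injective Δ -[1+ m ] (+ n)    _ q eq = ⊥-elim (ℕₚ.m+1+n≰m Δ (subst (_≤ Δ) (sym eq) q))
code-injective Δ -[1+ m ] -[1+ n ] _ _ eq = cong -[1+_] (ℕₚ.suc-injective (ℕₚ.+-cancelˡ-≡ Δ _ _ eq))

module _ {E : Set} where

  -- Elements equal modulo `e` differ by a multiple of `e`, and since `e ∷ z` has nonzero value, the
  -- values at `z` alone determine that multiple.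
  difference-injective : ∀ (F : Form E) {e z x y} → val F (e ∷ z) ≢ 0ℤ → F / e ⊢ x ~ y →
                         val F (x ∷ z) ≡ val F (y ∷ z) → F ⊢ x ~ y
  difference-injective F {e} {z} {x} {y} d≢0 x~y eq u = ℤₚ.i-j≡0⇒i≡j _ _ (ℤₚ.neg-injective (trans (flip (val F (x ∷ u)) _)
    (*-cancelˡ-≢0 d≢0 (begin
      val F (e ∷ z) * (val F (y ∷ u) - val F (x ∷ u))       ≡⟨ cramer-difference F x~y z u ⟩
      (val F (y ∷ z) - val F (x ∷ z)) * val F (e ∷ u)       ≡⟨ cong (_* val F (e ∷ u)) (ℤₚ.i≡j⇒i-j≡0 (sym eq)) ⟩
      0ℤ * val F (e ∷ u)                                    ≡⟨ ℤₚ.*-zeroˡ (val F (e ∷ u)) ⟩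
      0ℤ                                                    ≡⟨ ℤₚ.*-zeroʳ (val F (e ∷ z)) ⟨
      val F (e ∷ z) * 0ℤ                                    ∎))))
    where
    open ≡-Reasoning
    flip : ∀ a b → - (a - b) ≡ b - a
    flip = solve-∀

  atMost-fibre : ∀ (F : Form E) {Δ e z} → Bounded F Δ → val F (e ∷ z) ≢ 0ℤ →
                 ∀ x → AtMost (F ⊢_~_) (F / e ⊢ x ~_) (span-count Δ)
  atMost-fibre F {Δ} {e} {z} bnd d≢0 x l ≁l x~l = encode-length enc l (distinct l ≁l x~l)
    where
    enc : E → Fin (span-count Δ)
    enc y = fromℕ< (code-< Δ (val F (y ∷ z)) (bnd (y ∷ z)))

    enc-injective : ∀ {y y′} → F / e ⊢ x ~ y → F / e ⊢ x ~ y′ → ¬ F ⊢ y ~ y′ → enc y ≢ enc y′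
    enc-injective {y} {y′} x~y x~y′ y≁y′ eq = y≁y′ (difference-injective F d≢0
      (λ u → trans (sym (x~y u)) (x~y′ u))
      (code-injective Δ _ _ (bnd (y ∷ z)) (bnd (y′ ∷ z)) (Finₚ.fromℕ<-injective _ _ _ _ eq)))

    distinct : ∀ l → AllPairs (λ x y → ¬ F ⊢ x ~ y) l → All (F / e ⊢ x ~_) l → AllPairs (λ y y′ → enc y ≢ enc y′) l
    distinct []      []          []          = []
    distinct (y ∷ l) (y≁ ∷ ≁l) (x~y ∷ x~l) =
      All.zipWith (λ { (y≁y′ , x~y′) → enc-injective x~y x~y′ y≁y′ }) (y≁ , x~l) ∷ distinct l ≁l x~l

  -- Undoing one contraction multiplies the number of classes by at most 2Δ + 1; with all of `S`
  -- contracted only the null class is left.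
  atMost-span : ∀ (G : Form E) {Δ} → Bounded G Δ → ∀ S {u} → val G (S ++ u) ≢ 0ℤ →
                AtMost (G ⊢_~_) (Null (G ⫽ S)) (span-count Δ ℕ.^ length S)
  atMost-span G bnd []      _   = atMost-one (null-~ {F = G})
  atMost-span G {Δ} bnd (s ∷ S) d≢0 = subst (AtMost _ _) (ℕₚ.*-comm _ (span-count Δ))
    (atMost-fibres {R = G ⊢_~_} {R′ = G / s ⊢_~_} (~? (G / s) d≢0) (λ x u → refl) (atMost-fibre G bnd d≢0)
      (atMost-span (G / s) (bounded-/ G bnd s) S d≢0))

-- Doubled elements and their circuits

BothNonzero : ℤ → ℤ → Set
BothNonzero a b = a ≢ 0ℤ × b ≢ 0ℤ

bring : ∀ {E : Set} (x : E) xs ys v → xs ++ ys ++ x ∷ v ↭ x ∷ xs ++ ys ++ v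
bring x xs ys v = ↭-trans (++⁺ˡ xs (shift x ys v)) (shift x xs (ys ++ v))

module _ {E : Set} where

  -- This is y = x + (b/a)e with the denominator cleared. Unlike "equal modulo `e` but distinct", it
  -- passes to every contraction, even one where `x` and `y` become equal. `U` restricts the ratio:
  -- nonzero, or ±1.
  Shift : (ℤ → ℤ → Set) → Form E → E → E → E → Set
  Shift U F e x y = ∃ λ a → ∃ λ b → U a b × ∀ v → a * (val F (y ∷ v) - val F (x ∷ v)) ≡ b * val F (e ∷ v)

  shift-/ : ∀ {U} F {e x y} → Shift U F e x y → ∀ s → Shift U (F / s) e x y
  shift-/ F {e} {x} {y} (a , b , Uab , eq) s = a , b , Uab , λ v → begin
    a * (val F (s ∷ y ∷ v) - val F (s ∷ x ∷ v))       ≡⟨ cong₂ (λ p q → a * (p - q)) (swap F [] s y v) (swap F [] s x v) ⟩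
    a * (- val F (y ∷ s ∷ v) - - val F (x ∷ s ∷ v))   ≡⟨ outer a (val F (y ∷ s ∷ v)) (val F (x ∷ s ∷ v)) ⟩
    - (a * (val F (y ∷ s ∷ v) - val F (x ∷ s ∷ v)))   ≡⟨ cong -_ (eq (s ∷ v)) ⟩
    - (b * val F (e ∷ s ∷ v))                         ≡⟨ ℤₚ.neg-distribʳ-* b _ ⟩
    b * - val F (e ∷ s ∷ v)                           ≡⟨ cong (b *_) (swap F [] s e v) ⟨
    b * val F (s ∷ e ∷ v)                             ∎
    where
    open ≡-Reasoning
    outer : ∀ a p q → a * (- p - - q) ≡ - (a * (p - q))
    outer = solve-∀

  shift⇒~ : ∀ {U} F {e x y} → (∀ {a b} → U a b → a ≢ 0ℤ) → Shift U F e x y → F / e ⊢ x ~ y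
  shift⇒~ F {e} {x} {y} U⇒≢0 (a , b , Uab , eq) v =
    trans (swap F [] e x v) (trans (cong -_ (sym same)) (sym (swap F [] e y v)))
    where
    open ≡-Reasoning
    same : val F (y ∷ e ∷ v) ≡ val F (x ∷ e ∷ v)
    same = ℤₚ.i-j≡0⇒i≡j _ _ (*-cancelˡ-≢0 (U⇒≢0 Uab) (begin
      a * (val F (y ∷ e ∷ v) - val F (x ∷ e ∷ v))  ≡⟨ eq (e ∷ v) ⟩
      b * val F (e ∷ e ∷ v)                        ≡⟨ cong (b *_) (repeat F e v) ⟩
      b * 0ℤ                                       ≡⟨ ℤₚ.*-zeroʳ b ⟩
      0ℤ                                           ≡⟨ ℤₚ.*-zeroʳ a ⟨
      a * 0ℤ                                       ∎))

  -- Shaped for a recursion along the pairs: those already passed are frozen at their first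
  -- components by contraction, and `u` is a common completion. The nonzero value at `e` is what
  -- makes each recorded change independent of the later choices.
  data Spreadable (D : ℕ) (u : List E) (e : E) : Form E → List (E × E) → Set where
    []   : ∀ {F} → Spreadable D u e F []
    cons : ∀ {F x y P} → F / e ⊢ x ~ y → All (λ p → F / e ⊢ proj₁ p ~ proj₂ p) P →
           val F (e ∷ map proj₁ P ++ u) ≢ 0ℤ →
           D ≤ ∣ val F (y ∷ map proj₁ P ++ u) - val F (x ∷ map proj₁ P ++ u) ∣ →
           Spreadable D u e (F / x) P → Spreadable D u e F ((x , y) ∷ P)

  Choice : List (E × E) → List E → Set
  Choice = Pointwise (λ p x → x ≡ proj₁ p ⊎ x ≡ proj₂ p)

  choice-val : ∀ F {P c} → All (λ p → F ⊢ proj₁ p ~ proj₂ p) P → Choice P c →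
               ∀ u → val F (c ++ u) ≡ val F (map proj₁ P ++ u)
  choice-val F []         []              u = refl
  choice-val F {(x , y) ∷ P} (x~y ∷ p~) (inj₁ refl ∷ ch) u = choice-val (F / x) (All.map (λ r → ~-/ F r x) p~) ch u
  choice-val F {(x , y) ∷ P} (x~y ∷ p~) (inj₂ refl ∷ ch) u =
    trans (sym (x~y _)) (choice-val (F / x) (All.map (λ r → ~-/ F r x) p~) ch u)

  -- Replacing a vector by its partner changes the value by an amount which does not
  -- depend on the other replacements, so all the changes of one sign can be accumulated.
  spread : ∀ {D u e F P} → Spreadable D u e F P → ∃ λ hi → ∃ λ lo → Choice P hi × Choice P lo ×
           + (length P ℕ.* D) ℤ.≤ val F (hi ++ u) - val F (lo ++ u)
  spread {u = u} {F = F} [] = [] , [] , [] , [] , ℤₚ.≤-reflexive (sym (ℤₚ.+-inverseʳ (val F u)))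
  spread {D} {u} {e} {F} {(x , y) ∷ P} (cons x~y p~ d≢0 D≤ sp) with spread sp
  ... | hi , lo , chi , clo , bound = helper (ℤₚ.+∣i∣≡i⊎+∣i∣≡-i τ)
    where
    τ = val F (y ∷ map proj₁ P ++ u) - val F (x ∷ map proj₁ P ++ u)
    constant : ∀ {c} → Choice P c → val F (y ∷ c ++ u) - val F (x ∷ c ++ u) ≡ τ
    constant {c} ch = *-cancelˡ-≢0 d≢0 (begin
      val F (e ∷ map proj₁ P ++ u) * (val F (y ∷ c ++ u) - val F (x ∷ c ++ u)) ≡⟨ cramer-difference F x~y _ _ ⟩
      τ * val F (e ∷ c ++ u)               ≡⟨ cong (τ *_) (choice-val (F / e) p~ ch u) ⟩
      τ * val F (e ∷ map proj₁ P ++ u)     ≡⟨ ℤₚ.*-comm τ _ ⟩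
      val F (e ∷ map proj₁ P ++ u) * τ     ∎)
      where open ≡-Reasoning
    grow : ∀ {A B} → + D ℤ.≤ A → + (length P ℕ.* D) ℤ.≤ B → ∀ {C} → C ≡ A + B → + (D ℕ.+ length P ℕ.* D) ℤ.≤ C
    grow A≤ B≤ refl = ℤₚ.+-mono-≤ A≤ B≤
    add : ∀ a b c → a - c ≡ (a - b) + (b - c)
    add = solve-∀
    sub : ∀ a b c → a - c ≡ - (c - b) + (a - b)
    sub = solve-∀
    helper : + ∣ τ ∣ ≡ τ ⊎ + ∣ τ ∣ ≡ - τ → _
    helper (inj₁ τ≥0) = y ∷ hi , x ∷ lo , inj₂ refl ∷ chi , inj₁ refl ∷ clo ,
      grow (subst (+ D ℤ.≤_) (trans τ≥0 (sym (constant chi))) (ℤ.+≤+ D≤)) bound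
        (add (val F (y ∷ hi ++ u)) (val F (x ∷ hi ++ u)) (val F (x ∷ lo ++ u)))
    helper (inj₂ τ≤0) = x ∷ hi , y ∷ lo , inj₁ refl ∷ chi , inj₂ refl ∷ clo ,
      grow (subst (+ D ℤ.≤_) (trans τ≤0 (sym (cong -_ (constant clo)))) (ℤ.+≤+ D≤)) bound
        (sub (val F (x ∷ hi ++ u)) (val F (x ∷ lo ++ u)) (val F (y ∷ lo ++ u)))

  spread-∣∣ : ∀ {D u e F P} → Spreadable D u e F P → ∃ λ hi → ∃ λ lo → Choice P hi × Choice P lo ×
              length P ℕ.* D ≤ ∣ val F (hi ++ u) ∣ ℕ.+ ∣ val F (lo ++ u) ∣
  spread-∣∣ {u = u} {F = F} sp with spread sp
  ... | hi , lo , chi , clo , bound = hi , lo , chi , clo ,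
    ℕₚ.≤-trans (+≤⇒≤∣∣ bound) (ℤₚ.∣i-j∣≤∣i∣+∣j∣ (val F (hi ++ u)) (val F (lo ++ u)))
    where
    +≤⇒≤∣∣ : ∀ {n i} → + n ℤ.≤ i → n ≤ ∣ i ∣
    +≤⇒≤∣∣ (ℤ.+≤+ n≤) = n≤

  module _ {U : ℤ → ℤ → Set} {W : ℕ → Set} {D : ℕ}
           (U⇒≢0 : ∀ {a b} → U a b → a ≢ 0ℤ) (W⇒≢0 : ∀ {d} → W ∣ d ∣ → d ≢ 0ℤ)
           (weigh : ∀ {a b d t} → U a b → W ∣ d ∣ → a * t ≡ b * d → D ≤ ∣ t ∣) where

    -- Replacing `x` by `y` changes the value by b/a times the value with `e` in place of `x`, so
    -- only the sizes of the one-element deletions matter. `W` and `D` stay abstract to serve both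
    -- uses: nonzero deletions with `D` = 1, and deletions all of one size `D`.
    spreadable : ∀ {e u} P F → All (λ p → Shift U F e (proj₁ p) (proj₂ p)) P →
      (∀ L₁ s L₂ → map proj₁ P ≡ L₁ ++ s ∷ L₂ → W ∣ val F (e ∷ L₁ ++ L₂ ++ u) ∣) → Spreadable D u e F P
    spreadable []            F []        nz = []
    spreadable {e} {u} ((x , y) ∷ P) F (sh@(a , b , Uab , eq) ∷ shs) nz =
      cons (shift⇒~ F U⇒≢0 sh) (All.map (shift⇒~ F U⇒≢0) shs) (W⇒≢0 W₀) (weigh Uab W₀ (eq _))
        (spreadable P (F / x) (All.map (λ s → shift-/ F s x) shs)
          λ L₁ s L₂ eq → subst W (∣val∣-↭ F (↭s e x ↭r)) (nz (x ∷ L₁) s L₂ (cong (x ∷_) eq)))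
      where
      W₀ : W ∣ val F (e ∷ map proj₁ P ++ u) ∣
      W₀ = nz [] x (map proj₁ P) refl

  pairs : ∀ {R : E → E → Set} {S} → All (λ x → ∃ (R x)) S → ∃ λ P → map proj₁ P ≡ S × All (λ p → R (proj₁ p) (proj₂ p)) P
  pairs []             = [] , refl , []
  pairs ((y , r) ∷ rs) with pairs rs
  ... | P , refl , all = (_ , y) ∷ P , refl , r ∷ all

  Doubled : Form E → E → E → Set
  Doubled F e x = ∃ λ y → Shift BothNonzero F e x y

  Ranked : Form E → ℕ → Set
  Ranked F q = ∀ l → val F l ≢ 0ℤ → length l ≡ q

  ranked-/ : ∀ F {q} → Ranked F (suc q) → ∀ e → Ranked (F / e) q
  ranked-/ F rk e l ≢0 = ℕₚ.suc-injective (rk (e ∷ l) ≢0)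

  -- Division-free way to say that `w` has a nonzero coefficient at each element of `S`: it can
  -- replace any of them in any basis. That `w` lies in the span of `S` is a separate hypothesis
  -- where circuits get extended.
  Circuit : Form E → List E → E → Set
  Circuit G S w = ∀ S₁ s S₂ → S ≡ S₁ ++ s ∷ S₂ → ∀ v → val G (S₁ ++ s ∷ S₂ ++ v) ≢ 0ℤ → val G (w ∷ S₁ ++ S₂ ++ v) ≢ 0ℤ

  deletions≢0 : ∀ G {S w u} → Circuit G S w → val G (S ++ u) ≢ 0ℤ →
    ∀ L₁ s L₂ → w ∷ S ≡ L₁ ++ s ∷ L₂ → val G (L₁ ++ L₂ ++ u) ≢ 0ℤ
  deletions≢0 G circ S≢0 []       s L₂ refl = S≢0
  deletions≢0 G {u = u} circ S≢0 (w ∷ L₁) s L₂ refl =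
    circ L₁ s L₂ refl _ (subst (λ t → val G t ≢ 0ℤ) (Listₚ.++-assoc L₁ (s ∷ L₂) u) S≢0)

  circuit-length : ∀ F {Δ e S w u} → Bounded F Δ → All (Doubled F e) (w ∷ S) → Circuit (F / e) S w →
                   val (F / e) (S ++ u) ≢ 0ℤ → length (w ∷ S) ≤ Δ ℕ.+ Δ
  circuit-length F {Δ} {e} {S} {w} {u} bnd dbl circ S≢0 with pairs dbl
  ... | P , eq , shifts with spread-∣∣ (spreadable {U = BothNonzero} {W = λ d → d ≢ 0} {D = 1} proj₁
          (λ d≢0 d≡0 → d≢0 (cong ∣_∣ d≡0)) weigh P F shifts
          λ L₁ s L₂ eq′ p → deletions≢0 (F / e) circ S≢0 L₁ s L₂ (trans (sym eq) eq′) (ℤₚ.∣i∣≡0⇒i≡0 p))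
    where
    weigh : ∀ {a b d t} → BothNonzero a b → ∣ d ∣ ≢ 0 → a * t ≡ b * d → 1 ≤ ∣ t ∣
    weigh {a} {t = t} (a≢0 , b≢0) d≢0 eq =
      ℕₚ.n≢0⇒n>0 λ p → *-≢0 b≢0 (λ q → d≢0 (cong ∣_∣ q)) (trans (sym eq) (trans (cong (a *_) (ℤₚ.∣i∣≡0⇒i≡0 {t} p)) (ℤₚ.*-zeroʳ a)))
  ... | hi , lo , _ , _ , bound = begin
    length (w ∷ S)                                    ≡⟨ cong length eq ⟨
    length (map proj₁ P)                              ≡⟨ Listₚ.length-map proj₁ P ⟩
    length P                                          ≡⟨ ℕₚ.*-identityʳ _ ⟨
    length P ℕ.* 1                                    ≤⟨ bound ⟩
    ∣ val F (hi ++ u) ∣ ℕ.+ ∣ val F (lo ++ u) ∣       ≤⟨ ℕₚ.+-mono-≤ (bnd (hi ++ u)) (bnd (lo ++ u)) ⟩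
    Δ ℕ.+ Δ                                           ∎
    where open ℕₚ.≤-Reasoning

-- A linear bound on the number of doubled classes

loss : ℕ → ℕ
loss Δ = span-count Δ ℕ.^ (Δ ℕ.+ Δ)

module _ {E : Set} where

  shift-between : ∀ (G : Form E) {w z f g} → val G (w ∷ z) ≢ 0ℤ → G / w ⊢ f ~ g → ¬ G ⊢ f ~ g →
                  Shift BothNonzero G w f g
  shift-between G {w} {z} d≢0 f~g f≁g = val G (w ∷ z) , _ ,
    (d≢0 , λ τ≡0 → f≁g (difference-injective G d≢0 f~g (sym (ℤₚ.i-j≡0⇒i≡j _ _ τ≡0)))) , cramer-difference G f~g z

  shift-stays : ∀ (G : Form E) {w f g} → Shift BothNonzero G w f g → ∀ v → val G (w ∷ v) ≡ 0ℤ → val G (g ∷ v) ≡ val G (f ∷ v)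
  shift-stays G (a , b , (a≢0 , _) , eq) v w≡0 = ℤₚ.i-j≡0⇒i≡j _ _ (*-cancelˡ-≢0 a≢0
    (trans (eq v) (trans (cong (b *_) w≡0) (trans (ℤₚ.*-zeroʳ b) (sym (ℤₚ.*-zeroʳ a))))))

  shift-moves : ∀ (G : Form E) {w f g} → Shift BothNonzero G w f g → ∀ v → val G (f ∷ v) ≡ 0ℤ → val G (w ∷ v) ≢ 0ℤ → val G (g ∷ v) ≢ 0ℤ
  shift-moves G (a , b , (_ , b≢0) , eq) v f≡0 w≢0 g≡0 = *-≢0 b≢0 w≢0
    (trans (sym (eq v)) (trans (cong₂ (λ p q → a * (p - q)) g≡0 f≡0) (ℤₚ.*-zeroʳ a)))

  module _ (G : Form E) {S w f g} (circ : Circuit G S w) (w∈S : ∀ v → val G (S ++ w ∷ v) ≡ 0ℤ)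
           (sh : Shift BothNonzero G w f g) where

    w∷S≡0 : ∀ v → val G (w ∷ S ++ v) ≡ 0ℤ
    w∷S≡0 v = val≡0-↭ G (shift w S v) (w∈S v)

    -- Since g - f is a nonzero multiple of `w`, substituting it for `w` turns the relation on
    -- `w ∷ S` into one on `f`, `g` and `S`. When `f` is replaced, `g` acts like `f` because `w`
    -- vanishes next to `S`; when some `s` is replaced, `g` next to `f` acts like a multiple of `w`.
    circuit-extend : Circuit G (f ∷ S) g
    circuit-extend []       s S₂ refl v ≢0 p = ≢0 (trans (sym (shift-stays G sh _ (w∷S≡0 v))) p)
    circuit-extend (_ ∷ S₁) s S₂ refl v ≢0 = shift-moves G sh _ (repeat G f _)
      (val≢0-↭ G (↭p w (bring f S₁ S₂ v))
        (circ S₁ s S₂ refl (f ∷ v) (val≢0-↭ G (↭-sym (bring f S₁ (s ∷ S₂) v)) ≢0)))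

    span-extend : ∀ v → val G (f ∷ S ++ g ∷ v) ≡ 0ℤ
    span-extend v = val≡0-↭ G (↭-sym (shift g (f ∷ S) v)) (trans
      (shift-stays G sh _ (val≡0-↭ G (↭p w (shift f S v)) (w∷S≡0 (f ∷ v)))) (repeat G f _))

  module _ (Δ : ℕ) where

    -- Contract a doubled `w`. Classes that stay distinct are counted by recursion on the rank. The
    -- merged ones number at most `loss Δ`, unless one of them lies outside the span of the current
    -- circuit; then it and its representative replace `w` in a circuit longer by one. The length
    -- bound 2Δ ends this growth.
    doubled-count : ∀ q (F : Form E) e {z} → Ranked F (suc q) → Bounded F Δ → val F (e ∷ z) ≢ 0ℤ →
                    AtMost (F / e ⊢_~_) (Doubled F e) (loss Δ ℕ.* q ℕ.+ 1)
    doubled-count q F e {z} rk bnd e≢0 l ≁l dbl with All.decide (null? (F / e) {z} e≢0) l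
    ... | inj₁ null = ℕₚ.≤-trans (atMost-one (null-~ {F = F / e}) l ≁l null) (ℕₚ.m≤n+m 1 _)
    doubled-count zero    F e rk bnd e≢0 l ≁l dbl | inj₂ some with Any.satisfied some
    ... | y , u , y≢0 with rk (e ∷ y ∷ u) y≢0
    ... | ()
    doubled-count (suc q) F e {z} rk bnd e≢0 l ≁l dbl | inj₂ some with All.lookupAny dbl some
    -- The start is the degenerate circuit of `y` parallel to itself. There `S` has one element,
    -- hence the initial fuel 2Δ - 1.
    ... | dbl-y , u , y≢0 = grow (pred (Δ ℕ.+ Δ)) [ y ] y
            (trans (ℕₚ.+-comm _ 1) (ℕₚ.suc-pred (Δ ℕ.+ Δ) {{ℕ.>-nonZero Δ+Δ>0}}))
            (dbl-y ∷ []) dbl-y single (λ v → repeat G y v) (u , y≢0) (u , y≢0)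
      where
      G = F / e
      y = Any.lookup some

      Δ+Δ>0 : 0 < Δ ℕ.+ Δ
      Δ+Δ>0 = ℕₚ.≤-trans (ℕₚ.≤-trans (ℕₚ.n≢0⇒n>0 (λ p → e≢0 (ℤₚ.∣i∣≡0⇒i≡0 p))) (bnd _)) (ℕₚ.m≤m+n Δ Δ)

      single : Circuit G [ y ] y
      single []       s S₂ refl v ≢0 = ≢0
      single (x ∷ []) s S₂ ()
      single (x ∷ x′ ∷ S₁) s S₂ ()

      grow : ∀ fuel S w → fuel ℕ.+ length S ≡ Δ ℕ.+ Δ → All (Doubled F e) S → Doubled F e w → Circuit G S w →
             (∀ v → val G (S ++ w ∷ v) ≡ 0ℤ) → (∃ λ u → val G (S ++ u) ≢ 0ℤ) → (∃ λ u → val G (w ∷ u) ≢ 0ℤ) →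
             length l ≤ loss Δ ℕ.* suc q ℕ.+ 1
      grow fuel S w fuel≡ dbl-S dbl-w circ w∈S (u , S≢0) (u′ , w≢0) = result (length second ℕₚ.≤? loss Δ)
        where
        open Split (split {R = G / w ⊢_~_} {S = λ x y → ¬ G ⊢ x ~ y} (~? (G / w) w≢0) (λ n p → n (~-sym {F = G} p)) l ≁l)

        first≤ : length first ≤ loss Δ ℕ.* q ℕ.+ 1
        first≤ = doubled-count q (F / w) e (ranked-/ F rk w) (bounded-/ F bnd w)
          (val≢0-↭ F (↭s e w ↭r) w≢0) first
          (AllPairs.map (λ n p → n (~-swap F p)) first-distinct)
          (All.map (λ { (y , sh) → y , shift-/ F sh w }) (all-first dbl))

        extend : ∀ fuel → fuel ℕ.+ length S ≡ Δ ℕ.+ Δ → Any (λ f → ∃ λ v → val (G ⫽ S) (f ∷ v) ≢ 0ℤ) second →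
                 length l ≤ loss Δ ℕ.* suc q ℕ.+ 1
        -- No fuel means that `S` has 2Δ elements, so the circuit `w ∷ S` has one too many.
        extend zero       fuel≡ _  = ⊥-elim (ℕₚ.1+n≰n (subst (length (w ∷ S) ≤_) (sym fuel≡)
          (circuit-length F bnd (dbl-w ∷ dbl-S) circ S≢0)))
        extend (suc fuel) fuel≡ at with All.lookupAny (All.zip (related , All.zip (cross-S , all-second dbl))) at
        ... | (rel , cross , dbl-f) , v , f≢0 with All.lookupAny (All.zip (cross , all-first dbl)) rel
        ... | (f≁g , dbl-g) , f~g = grow fuel (f ∷ S) _ (trans (ℕₚ.+-suc fuel _) fuel≡) (dbl-f ∷ dbl-S) dbl-g
              (circuit-extend G circ w∈S sh) (span-extend G circ w∈S sh) (v , fS≢0)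
              (S ++ v , circuit-extend G circ w∈S sh [] f S refl v fS≢0)
          where
          f = Any.lookup at
          sh = shift-between G w≢0 f~g f≁g
          fS≢0 : val G (f ∷ S ++ v) ≢ 0ℤ
          fS≢0 = val≢0-↭ G (shift f S v) (subst (_≢ 0ℤ) (val-⫽ G S (f ∷ v)) f≢0)

        result : Dec (length second ≤ loss Δ) → length l ≤ loss Δ ℕ.* suc q ℕ.+ 1
        result (yes second≤) = begin
          length l                                    ≡⟨ length-split ⟩
          length first ℕ.+ length second              ≤⟨ ℕₚ.+-mono-≤ first≤ second≤ ⟩
          loss Δ ℕ.* q ℕ.+ 1 ℕ.+ loss Δ                   ≡⟨ rearrange (loss Δ) q ⟩
          loss Δ ℕ.* suc q ℕ.+ 1                        ∎
          where
          open ℕₚ.≤-Reasoning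
          rearrange : ∀ k q → k ℕ.* q ℕ.+ 1 ℕ.+ k ≡ k ℕ.* suc q ℕ.+ 1
          rearrange = ℕsolve-∀
        result (no second≰) with All.decide (null? (G ⫽ S) {u} (λ p → S≢0 (trans (sym (val-⫽ G S u)) p))) second
        ... | inj₂ at   = extend fuel fuel≡ at
        -- If all of `second` lay in the span of `S`, it would have at most (2Δ + 1)^|S| members;
        -- |S| ≤ 2Δ makes this at most `loss Δ`.
        ... | inj₁ null = ⊥-elim (second≰ (ℕₚ.≤-trans (atMost-span G (bounded-/ F bnd e) S S≢0 second second-S null)
              (ℕₚ.^-monoʳ-≤ (span-count Δ) (subst (length S ≤_) fuel≡ (ℕₚ.m≤n+m (length S) fuel)))))

-- Unit ratios, rows lost by a contraction, minimal circuits

Unit : ℤ → ℤ → Set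
Unit a b = a ≢ 0ℤ × ∣ a ∣ ≡ ∣ b ∣

∣i∣≡∣j∣⇒i≡±j : ∀ i j → ∣ i ∣ ≡ ∣ j ∣ → i ≡ j ⊎ i ≡ - j
∣i∣≡∣j∣⇒i≡±j (+ m)    (+ n)    eq   = inj₁ (cong +_ eq)
∣i∣≡∣j∣⇒i≡±j (+ m)    -[1+ n ] refl = inj₂ refl
∣i∣≡∣j∣⇒i≡±j -[1+ m ] (+ n)    refl = inj₂ refl
∣i∣≡∣j∣⇒i≡±j -[1+ m ] -[1+ n ] refl = inj₁ refl

-- Equal sizes force a = ±b, so a - b is 0 or ±2b, and neither has the size of `b` unless all
-- vanish.
triangle : ∀ {a b d} → ∣ a ∣ ≡ ∣ d ∣ → ∣ b ∣ ≡ ∣ d ∣ → ∣ a - b ∣ ≡ ∣ d ∣ → d ≡ 0ℤ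
triangle {a} {b} {d} a≡d b≡d a-b≡d with ∣i∣≡∣j∣⇒i≡±j a b (trans a≡d (sym b≡d))
... | inj₁ refl = ℤₚ.∣i∣≡0⇒i≡0 (trans (sym a-b≡d) (cong ∣_∣ (ℤₚ.+-inverseʳ a)))
... | inj₂ refl = ℤₚ.∣i∣≡0⇒i≡0 (ℕₚ.m+n≡0⇒m≡0 ∣ d ∣ (ℕₚ.+-cancelʳ-≡ ∣ d ∣ _ 0 (begin
  ∣ d ∣ ℕ.+ 0 ℕ.+ ∣ d ∣       ≡⟨ cong (ℕ._+ ∣ d ∣) (ℕₚ.+-identityʳ ∣ d ∣) ⟩
  ∣ d ∣ ℕ.+ ∣ d ∣             ≡⟨ cong (λ t → t ℕ.+ t) (sym b≡d) ⟩
  ∣ b ∣ ℕ.+ ∣ b ∣             ≡⟨ cong (∣ b ∣ ℕ.+_) (ℕₚ.+-identityʳ ∣ b ∣) ⟨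
  2 ℕ.* ∣ b ∣                 ≡⟨ ℤₚ.abs-* (- + 2) b ⟨
  ∣ - + 2 * b ∣               ≡⟨ cong ∣_∣ (double b) ⟨
  ∣ - b - b ∣                 ≡⟨ a-b≡d ⟩
  ∣ d ∣                       ∎)))
  where
  open ≡-Reasoning
  double : ∀ b → - b - b ≡ - + 2 * b
  double = solve-∀

-- A lost row is doubled: the first factor counts the classes of such rows modulo `e`, the second
-- the rows in one class.
contraction-loss : ℕ → ℕ → ℕ
contraction-loss Δ q = (loss Δ ℕ.* q ℕ.+ 1) ℕ.* span-count Δ

contraction-loss-mono : ∀ Δ {p q} → p ≤ q → contraction-loss Δ p ≤ contraction-loss Δ q
contraction-loss-mono Δ p≤q = ℕₚ.*-monoˡ-≤ (span-count Δ) (ℕₚ.+-monoˡ-≤ 1 (ℕₚ.*-monoʳ-≤ (loss Δ) p≤q))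

module _ {E : Set} where

  -- Here and in the next two lemmas `X` is an early exit; it will be instantiated with `Drop`.
  traverse : ∀ {X : Set} {P Q : E → Set} → (∀ {x} → P x → X ⊎ Q x) → ∀ {l} → All P l → X ⊎ All Q l
  traverse f []       = inj₂ []
  traverse f (p ∷ ps) with f p | traverse f ps
  ... | inj₁ x | _       = inj₁ x
  ... | inj₂ _ | inj₁ x  = inj₁ x
  ... | inj₂ q | inj₂ qs = inj₂ (q ∷ qs)

  distinct-or : ∀ {X : Set} {P : E → Set} {S R : E → E → Set} → (∀ x y → Dec (R x y)) →
    (∀ {x y} → P x → P y → S x y → R x y → X) → ∀ {l} → All P l → AllPairs S l → X ⊎ AllPairs (λ x y → ¬ R x y) l
  distinct-or R? collide [] [] = inj₂ []
  distinct-or {R = R} R? collide {x ∷ l} (px ∷ pl) (sx ∷ sl) with distinct-or R? collide pl sl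
  ... | inj₁ found = inj₁ found
  ... | inj₂ ≁l with traverse (λ {y} (py , s) → helper py s (R? x y)) (All.zip (pl , sx))
    where
    helper : ∀ {y} → _ → _ → Dec (R x y) → _
    helper py s (yes r) = inj₁ (collide px py s r)
    helper py s (no ¬r) = inj₂ ¬r
  ... | inj₁ found = inj₁ found
  ... | inj₂ x≁l   = inj₂ (x≁l ∷ ≁l)

  positions : ∀ {X : Set} {Q : List E → List E → Set} T →
    (∀ T₁ s T₂ → T ≡ T₁ ++ s ∷ T₂ → X ⊎ Q T₁ T₂) → X ⊎ (∀ T₁ s T₂ → T ≡ T₁ ++ s ∷ T₂ → Q T₁ T₂)
  positions []      f = inj₂ λ { [] s T₂ () ; (_ ∷ _) s T₂ () }
  positions {Q = Q} (x ∷ T) f with f [] x T refl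
     | positions {Q = λ T₁ T₂ → Q (x ∷ T₁) T₂} T (λ T₁ s T₂ eq → f (x ∷ T₁) s T₂ (cong (x ∷_) eq))
  ... | inj₁ found | _          = inj₁ found
  ... | inj₂ _     | inj₁ found = inj₁ found
  ... | inj₂ q     | inj₂ qs    = inj₂ λ { [] s T₂ refl → q ; (_ ∷ T₁) s T₂ refl → qs T₁ s T₂ refl }

  nonnull? : ∀ (G : Form E) {b} → val G b ≢ 0ℤ → ∀ x → Dec (∃ λ u → val G (x ∷ u) ≢ 0ℤ)
  nonnull? G b≢0 x with null? G b≢0 x
  ... | inj₁ null = no λ { (u , ≢0) → ≢0 (null u) }
  ... | inj₂ some = yes some

  module _ (Δ : ℕ) where

    atMost-/ : ∀ q (F : Form E) e {z n} → Ranked F (suc q) → Bounded F Δ → val F (e ∷ z) ≢ 0ℤ →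
               AtMost (F / e ⊢_~_) (λ _ → ⊤) n → AtMost (F ⊢_~_) (λ _ → ⊤) (n ℕ.+ contraction-loss Δ q)
    atMost-/ q F e {n = n} rk bnd e≢0 am l ≁l _ = subst (_≤ n ℕ.+ contraction-loss Δ q) (sym length-split)
      (ℕₚ.+-mono-≤ (am first first-distinct (All.universal (λ _ → tt) first))
        (atMost-fibres {R = F ⊢_~_} {R′ = F / e ⊢_~_} (~? (F / e) e≢0) (λ x u → refl) (atMost-fibre F bnd e≢0)
          (doubled-count Δ q F e rk bnd e≢0) second second-S
          (All.zipWith (λ { (rel , cross) → doubled rel cross }) (related , cross-S))))
      where
      open Split (split {R = F / e ⊢_~_} {S = λ x y → ¬ F ⊢ x ~ y} (~? (F / e) e≢0) (λ n p → n (~-sym {F = F} p)) l ≁l)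
      doubled : ∀ {y} → Any (F / e ⊢ y ~_) first → All (λ x → ¬ F ⊢ y ~ x) first → Doubled F e y
      doubled rel cross with All.lookupAny cross rel
      ... | y≁x , y~x = _ , shift-between F e≢0 y~x y≁x

    atMost-⫽ : ∀ A {q Q} (F : Form E) {u n} → q ≤ Q → Ranked F q → Bounded F Δ → val F (A ++ u) ≢ 0ℤ →
               AtMost (F ⫽ A ⊢_~_) (λ _ → ⊤) n → AtMost (F ⊢_~_) (λ _ → ⊤) (n ℕ.+ length A ℕ.* contraction-loss Δ Q)
    atMost-⫽ []      F {n = n} q≤Q rk bnd A≢0 am = subst (AtMost _ _) (sym (ℕₚ.+-identityʳ n)) am
    atMost-⫽ (a ∷ A) {zero}  F q≤Q rk bnd A≢0 am with rk _ A≢0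
    ... | ()
    atMost-⫽ (a ∷ A) {suc q} {Q} F {n = n} q≤Q rk bnd A≢0 am l ≁l pl = ℕₚ.≤-trans
      (atMost-/ q F a rk bnd A≢0 (atMost-⫽ A {q} {Q} (F / a) (ℕₚ.<⇒≤ q≤Q) (ranked-/ F rk a) (bounded-/ F bnd a) A≢0 am) l ≁l pl)
      (begin
        n ℕ.+ length A ℕ.* contraction-loss Δ Q ℕ.+ contraction-loss Δ q ≤⟨ ℕₚ.+-monoʳ-≤ _ (contraction-loss-mono Δ (ℕₚ.<⇒≤ q≤Q)) ⟩
        n ℕ.+ length A ℕ.* contraction-loss Δ Q ℕ.+ contraction-loss Δ Q ≡⟨ rearrange n (length A) (contraction-loss Δ Q) ⟩
        n ℕ.+ suc (length A) ℕ.* contraction-loss Δ Q                  ∎)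
      where
      open ℕₚ.≤-Reasoning
      rearrange : ∀ n a k → n ℕ.+ a ℕ.* k ℕ.+ k ≡ n ℕ.+ suc a ℕ.* k
      rearrange = ℕsolve-∀

  -- After contracting `s` and recursing, either the `T` found already spans `f` in `G`, and `s` is
  -- omitted, or `s` is indispensable and joins `T`.
  minimal-circuit : ∀ S (G : Form E) f {u} → val G (S ++ u) ≢ 0ℤ → Null (G ⫽ S) f →
    ∃ λ T → T ⊆ S × (∃ λ u → val G (T ++ u) ≢ 0ℤ) × Null (G ⫽ T) f ×
      (∀ T₁ s T₂ → T ≡ T₁ ++ s ∷ T₂ → ¬ Null (G ⫽ (T₁ ++ T₂)) f)
  minimal-circuit []      G f {u} S≢0 null = [] , [] , (u , S≢0) , null , λ { [] s T₂ () ; (_ ∷ _) s T₂ () }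
  minimal-circuit (s ∷ S) G f {u} S≢0 null with minimal-circuit S (G / s) f {u} S≢0 null
  ... | T , T⊆ , (v , T≢0) , nullT , minT = helper (null? (G ⫽ T) {s ∷ v} (λ p → T≢0′ (trans (sym (val-⫽ G T (s ∷ v))) p)) f)
    where
    T≢0′ : val G (T ++ s ∷ v) ≢ 0ℤ
    T≢0′ = val≢0-↭ G (↭-sym (shift s T v)) T≢0
    down : ∀ R → Null (G ⫽ R) f → Null ((G / s) ⫽ R) f
    down R nullR = null-⫽ (G / s) R λ u → val≡0-↭ G (shift s R (f ∷ u))
      (val≡0-↭ G (++⁺ˡ R (↭s f s ↭r)) (⫽-null G R nullR (s ∷ u)))
    helper : Null (G ⫽ T) f ⊎ _ → _
    helper (inj₁ nullT′) = T , s ∷ʳ T⊆ , (s ∷ v , T≢0′) , nullT′ , λ T₁ t T₂ eq n → minT T₁ t T₂ eq (down (T₁ ++ T₂) n)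
    helper (inj₂ (w , ≢0)) = s ∷ T , refl ∷ T⊆ , (v , T≢0) , nullT ,
      λ { [] t T₂ refl n → ≢0 (n w) ; (_ ∷ T₁) t T₂ refl n → minT T₁ t T₂ refl n }

  module _ {G : Form E} {T f u} (T≢0 : val G (T ++ u) ≢ 0ℤ) (null : Null (G ⫽ T) f)
           (minimal : ∀ T₁ s T₂ → T ≡ T₁ ++ s ∷ T₂ → ¬ Null (G ⫽ (T₁ ++ T₂)) f) where

    -- Modulo the rest of `T`, `f` is a multiple of `s`, so `cramer` applies. The ratio of the two
    -- values at `u` is the coefficient of `s` in `f`; minimality makes it nonzero in `exchanged≢0`.
    exchangeable : ∀ T₁ s T₂ → T ≡ T₁ ++ s ∷ T₂ → ∀ v →
      val G ((T₁ ++ T₂) ++ s ∷ u) * val G ((T₁ ++ T₂) ++ f ∷ v) ≡ val G ((T₁ ++ T₂) ++ f ∷ u) * val G ((T₁ ++ T₂) ++ s ∷ v)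
    exchangeable T₁ s T₂ refl v = trans (cong₂ _*_ (sym (val-⫽ G R (s ∷ u))) (sym (val-⫽ G R (f ∷ v))))
      (trans (cramer (G ⫽ R) null′ u v) (cong₂ _*_ (val-⫽ G R (f ∷ u)) (val-⫽ G R (s ∷ v))))
      where
      R = T₁ ++ T₂
      null′ : Null (G ⫽ R / s) f
      null′ w = trans (val-⫽ G R (s ∷ f ∷ w)) (val≡0-↭ G
        (↭-sym (↭-trans (shift s R (f ∷ w)) (↭-trans (↭p s (↭-reflexive (Listₚ.++-assoc T₁ T₂ (f ∷ w))))
          (↭-sym (↭-trans (↭-reflexive (Listₚ.++-assoc T₁ (s ∷ T₂) (f ∷ w))) (shift s T₁ (T₂ ++ f ∷ w)))))))
        (⫽-null G T null w))

    removed≢0 : ∀ T₁ s T₂ → T ≡ T₁ ++ s ∷ T₂ → val G ((T₁ ++ T₂) ++ s ∷ u) ≢ 0ℤ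
    removed≢0 T₁ s T₂ refl = val≢0-↭ G (↭-sym (↭-trans (shift s (T₁ ++ T₂) u) (↭-trans
      (↭p s (↭-reflexive (Listₚ.++-assoc T₁ T₂ u)))
      (↭-sym (↭-trans (↭-reflexive (Listₚ.++-assoc T₁ (s ∷ T₂) u)) (shift s T₁ (T₂ ++ u))))))) T≢0

    exchanged≢0 : ∀ T₁ s T₂ → T ≡ T₁ ++ s ∷ T₂ → val G ((T₁ ++ T₂) ++ f ∷ u) ≢ 0ℤ
    exchanged≢0 T₁ s T₂ eq f≡0 with null? (G ⫽ (T₁ ++ T₂)) {s ∷ u}
      (λ p → removed≢0 T₁ s T₂ eq (trans (sym (val-⫽ G (T₁ ++ T₂) _)) p)) f
    ... | inj₁ n        = minimal T₁ s T₂ eq n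
    ... | inj₂ (v , ≢0) = *-≢0 (removed≢0 T₁ s T₂ eq) (subst (_≢ 0ℤ) (val-⫽ G (T₁ ++ T₂) (f ∷ v)) ≢0)
      (trans (exchangeable T₁ s T₂ eq v) (trans (cong (_* val G ((T₁ ++ T₂) ++ s ∷ v)) f≡0) (ℤₚ.*-zeroˡ (val G ((T₁ ++ T₂) ++ s ∷ v)))))

    minimal⇒circuit : Circuit G T f
    minimal⇒circuit T₁ s T₂ eq v s≢0 f≡0 = *-≢0 (exchanged≢0 T₁ s T₂ eq) (val≢0-↭ G to s≢0)
      (trans (sym (exchangeable T₁ s T₂ eq v)) (trans (cong (val G ((T₁ ++ T₂) ++ s ∷ u) *_)
        (val≡0-↭ G from f≡0)) (ℤₚ.*-zeroʳ (val G ((T₁ ++ T₂) ++ s ∷ u)))))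
      where
      from : ∀ {x} → x ∷ T₁ ++ T₂ ++ v ↭ (T₁ ++ T₂) ++ x ∷ v
      from {x} = ↭-sym (↭-trans (shift x (T₁ ++ T₂) v) (↭p x (↭-reflexive (Listₚ.++-assoc T₁ T₂ v))))
      to : T₁ ++ s ∷ T₂ ++ v ↭ (T₁ ++ T₂) ++ s ∷ v
      to = ↭-trans (shift s T₁ (T₂ ++ v)) from

-- Unimodularity

large-summand : ∀ {n D a b} → 1 ≤ D → 3 ≤ n → n ℕ.* D ≤ a ℕ.+ b → D < a ⊎ D < b
large-summand {n} {D} {a} {b} D>0 n≥3 n*D≤a+b with D ℕₚ.<? a | D ℕₚ.<? b
... | yes D<a | _       = inj₁ D<a
... | no _    | yes D<b = inj₂ D<b
... | no D≮a  | no D≮b  = ⊥-elim (ℕₚ.<-irrefl refl (begin-strict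
  2 ℕ.* D          <⟨ ℕₚ.*-monoˡ-< D {{ℕ.>-nonZero D>0}} n≥3 ⟩
  n ℕ.* D          ≤⟨ n*D≤a+b ⟩
  a ℕ.+ b          ≤⟨ ℕₚ.+-mono-≤ (ℕₚ.≮⇒≥ D≮a) (ℕₚ.≮⇒≥ D≮b) ⟩
  D ℕ.+ D          ≡⟨ cong (D ℕ.+_) (ℕₚ.+-identityʳ D) ⟨
  2 ℕ.* D          ∎))
  where open ℕₚ.≤-Reasoning

module Unimodular {E : Set} (F : Form E) {e z} (Δ′ : ℕ) (bnd : Bounded F (suc Δ′)) (e≢0 : val F (e ∷ z) ≢ 0ℤ) where

  Δ : ℕ
  Δ = suc Δ′

  G : Form E
  G = F / e

  -- Contracting A lowers the bound on the form from Δ to Δ′.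
  Drop : Set
  Drop = ∃ λ A → length A ≤ Δ ℕ.+ Δ × (∃ λ u → val F (A ++ u) ≢ 0ℤ) × (∀ v → ∣ val F (A ++ v) ∣ ≤ Δ′)

  module _ {A B d t u} (eq : ∀ v → d * val F (A ++ v) ≡ t * val F (B ++ v)) (t≢0 : t ≢ 0ℤ) (B≢0 : val F (B ++ u) ≢ 0ℤ) where

    proportional≢0 : val F (A ++ u) ≢ 0ℤ
    proportional≢0 A≡0 = *-≢0 t≢0 B≢0 (trans (sym (eq u)) (trans (cong (d *_) A≡0) (ℤₚ.*-zeroʳ d)))

    drop-< : length A ≤ Δ ℕ.+ Δ → ∣ t ∣ < ∣ d ∣ → Drop
    drop-< A≤ t<d = A , A≤ , (u , proportional≢0) , λ v → ℕ.s≤s⁻¹ (ℕₚ.*-cancelˡ-< ∣ d ∣ _ Δ (begin-strict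
      ∣ d ∣ ℕ.* ∣ val F (A ++ v) ∣   ≡⟨ ℤₚ.abs-* d _ ⟨
      ∣ d * val F (A ++ v) ∣         ≡⟨ cong ∣_∣ (eq v) ⟩
      ∣ t * val F (B ++ v) ∣         ≡⟨ ℤₚ.abs-* t _ ⟩
      ∣ t ∣ ℕ.* ∣ val F (B ++ v) ∣   ≤⟨ ℕₚ.*-monoʳ-≤ ∣ t ∣ (bnd (B ++ v)) ⟩
      ∣ t ∣ ℕ.* Δ                    <⟨ ℕₚ.*-monoˡ-< Δ t<d ⟩
      ∣ d ∣ ℕ.* Δ                    ∎))
      where open ℕₚ.≤-Reasoning

  -- `A` and `B` have values in the constant ratio t/d. If its size is not 1, the set with the
  -- smaller values stays strictly below the bound attained by the other. Every `Drop` originates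
  -- here.
  drop-≢ : ∀ {A B d t u} → (∀ v → d * val F (A ++ v) ≡ t * val F (B ++ v)) → d ≢ 0ℤ → t ≢ 0ℤ → val F (B ++ u) ≢ 0ℤ →
           length A ≤ Δ ℕ.+ Δ → length B ≤ Δ ℕ.+ Δ → ∣ t ∣ ≢ ∣ d ∣ → Drop
  drop-≢ {A} {B} {d} {t} {u} eq d≢0 t≢0 B≢0 A≤ B≤ t≢d with ℕₚ.<-cmp ∣ t ∣ ∣ d ∣
  ... | tri< t<d _ _ = drop-< {A} {B} {d} {t} {u} eq t≢0 B≢0 A≤ t<d
  ... | tri≈ _ t≡d _ = ⊥-elim (t≢d t≡d)
  ... | tri> _ _ d<t = drop-< {B} {A} {t} {d} {u} (λ v → sym (eq v)) d≢0 (proportional≢0 {A} {B} {d} {t} {u} eq t≢0 B≢0) B≤ d<t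

  NonNull : E → Set
  NonNull x = ∃ λ u → val G (x ∷ u) ≢ 0ℤ

  unit-difference : ∀ {f x} → G ⊢ f ~ x → ¬ F ⊢ f ~ x → NonNull f → Drop ⊎ ∣ val F (x ∷ z) - val F (f ∷ z) ∣ ≡ ∣ val F (e ∷ z) ∣
  unit-difference {f} {x} f~x f≁x (u , f≢0) with ∣ val F (x ∷ z) - val F (f ∷ z) ∣ ℕₚ.≟ ∣ val F (e ∷ z) ∣
  ... | yes p = inj₂ p
  -- Next to `f`, the element `x` acts like x - f, a fixed multiple of `e`; a factor other than ±1
  -- is a forbidden ratio.
  ... | no ¬p = inj₁ (drop-≢ {x ∷ f ∷ []} {e ∷ f ∷ []} eq e≢0 t≢0 f≢0 2≤ 2≤ ¬p)
    where
    t≢0 : val F (x ∷ z) - val F (f ∷ z) ≢ 0ℤ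
    t≢0 = proj₂ (proj₁ (proj₂ (proj₂ (shift-between F e≢0 f~x f≁x))))
    2≤ : 2 ≤ Δ ℕ.+ Δ
    2≤ = s≤s (ℕₚ.≤-trans (s≤s z≤n) (ℕₚ.m≤n+m Δ Δ′))
    eq : ∀ v → val F (e ∷ z) * val F (x ∷ f ∷ v) ≡ (val F (x ∷ z) - val F (f ∷ z)) * val F (e ∷ f ∷ v)
    eq v = trans (cong (val F (e ∷ z) *_) (sym (trans (cong (λ t → val F (x ∷ f ∷ v) - t) (repeat F f v)) (ℤₚ.+-identityʳ _))))
                 (cramer-difference F f~x z (f ∷ v))

  UnitDoubled : E → Set
  UnitDoubled f = ∃ λ x → Shift Unit F e f x

  unit-shift : ∀ {f x} → G ⊢ f ~ x → ¬ F ⊢ f ~ x → NonNull f → Drop ⊎ UnitDoubled f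
  unit-shift {f} {x} f~x f≁x f≢0 with unit-difference f~x f≁x f≢0
  ... | inj₁ drop = inj₁ drop
  ... | inj₂ p    = inj₂ (x , val F (e ∷ z) , val F (x ∷ z) - val F (f ∷ z) , (e≢0 , sym p) , cramer-difference F f~x z)

  -- Three vectors differing pairwise by ±e cannot exist, by parity.
  collision : ∀ {f g x} → G ⊢ f ~ x → ¬ F ⊢ f ~ x → ¬ F ⊢ g ~ x → NonNull f → NonNull g → ¬ F ⊢ f ~ g → G ⊢ f ~ g → Drop
  collision {f} {g} {x} f~x f≁x g≁x f≢0 g≢0 f≁g f~g
    with unit-difference f~x f≁x f≢0 | unit-difference (~-trans {F = G} (~-sym {F = G} f~g) f~x) g≁x g≢0 | unit-difference f~g f≁g f≢0
  ... | inj₁ drop | _         | _         = drop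
  ... | inj₂ _    | inj₁ drop | _         = drop
  ... | inj₂ _    | inj₂ _    | inj₁ drop = drop
  ... | inj₂ p    | inj₂ p′   | inj₂ p″   = ⊥-elim (e≢0
    (triangle {val F (x ∷ z) - val F (f ∷ z)} {val F (x ∷ z) - val F (g ∷ z)} p p′
      (trans (cong ∣_∣ (cancel (val F (x ∷ z)) (val F (f ∷ z)) (val F (g ∷ z)))) p″)))
    where
    cancel : ∀ x f g → (x - f) - (x - g) ≡ g - f
    cancel = solve-∀

  Anti : E → E → Set
  Anti = Multiple -1ℤ G

  module _ {T f} (dbl-T : All UnitDoubled T) (dbl-f : UnitDoubled f) (f≢0 : NonNull f)
           (apart : All (λ s → ¬ G ⊢ f ~ s × ¬ Anti f s) T) {u} (T≢0 : val G (T ++ u) ≢ 0ℤ) (null : Null (G ⫽ T) f)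
           (minimal : ∀ T₁ s T₂ → T ≡ T₁ ++ s ∷ T₂ → ¬ Null (G ⫽ (T₁ ++ T₂)) f) where

    length-T : suc (length T) ≤ Δ ℕ.+ Δ
    length-T = circuit-length F bnd (weaken dbl-f ∷ All.map weaken dbl-T) (minimal⇒circuit T≢0 null minimal) T≢0
      where
      weaken : ∀ {x} → UnitDoubled x → Doubled F e x
      weaken (y , a , b , (a≢0 , a≡b) , eq) = y , a , b , (a≢0 , ∣∣-≢0 a≡b a≢0) , eq

    unit-coefficients : Drop ⊎ (∀ T₁ s T₂ → T ≡ T₁ ++ s ∷ T₂ → ∣ val G (f ∷ T₁ ++ T₂ ++ u) ∣ ≡ ∣ val G (T ++ u) ∣)
    unit-coefficients = positions T step
      where
      step : ∀ T₁ s T₂ → T ≡ T₁ ++ s ∷ T₂ → Drop ⊎ ∣ val G (f ∷ T₁ ++ T₂ ++ u) ∣ ≡ ∣ val G (T ++ u) ∣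
      step T₁ s T₂ refl with ∣ val G ((T₁ ++ T₂) ++ f ∷ u) ∣ ℕₚ.≟ ∣ val G ((T₁ ++ T₂) ++ s ∷ u) ∣
      ... | yes p = inj₂ (begin
        ∣ val G (f ∷ T₁ ++ T₂ ++ u) ∣       ≡⟨ cong (λ l → ∣ val G (f ∷ l) ∣) (Listₚ.++-assoc T₁ T₂ u) ⟨
        ∣ val G (f ∷ (T₁ ++ T₂) ++ u) ∣     ≡⟨ ∣val∣-↭ G (shift f (T₁ ++ T₂) u) ⟨
        ∣ val G ((T₁ ++ T₂) ++ f ∷ u) ∣     ≡⟨ p ⟩
        ∣ val G ((T₁ ++ T₂) ++ s ∷ u) ∣     ≡⟨ ∣val∣-↭ G (shift s (T₁ ++ T₂) u) ⟩
        ∣ val G (s ∷ (T₁ ++ T₂) ++ u) ∣     ≡⟨ cong (λ l → ∣ val G (s ∷ l) ∣) (Listₚ.++-assoc T₁ T₂ u) ⟩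
        ∣ val G (s ∷ T₁ ++ T₂ ++ u) ∣       ≡⟨ ∣val∣-↭ G (shift s T₁ (T₂ ++ u)) ⟨
        ∣ val G (T₁ ++ s ∷ T₂ ++ u) ∣       ≡⟨ cong (λ l → ∣ val G l ∣) (Listₚ.++-assoc T₁ (s ∷ T₂) u) ⟨
        ∣ val G ((T₁ ++ s ∷ T₂) ++ u) ∣     ∎)
        where open ≡-Reasoning
      -- A coefficient other than ±1. Prefixing `e` turns the relation in `G` into one in `F`,
      -- between sets of |T| + 1 elements, which `length-T` allows.
      ... | no ¬p = inj₁ (drop-≢ {e ∷ R ++ [ f ]} {e ∷ R ++ [ s ]} {u = u}
          (λ v → subst₂ (λ l l′ → val G (R ++ s ∷ u) * val G l ≡ val G (R ++ f ∷ u) * val G l′)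
                   (sym (Listₚ.++-assoc R [ f ] v)) (sym (Listₚ.++-assoc R [ s ] v)) (exchangeable T≢0 null minimal T₁ s T₂ refl v))
          (removed≢0 T≢0 null minimal T₁ s T₂ refl) (exchanged≢0 T≢0 null minimal T₁ s T₂ refl)
          (subst (λ l → val G l ≢ 0ℤ) (sym (Listₚ.++-assoc R [ s ] u)) (removed≢0 T≢0 null minimal T₁ s T₂ refl))
          (size f) (size s) ¬p)
        where
        R = T₁ ++ T₂
        size : ∀ x → suc (length (R ++ [ x ])) ≤ Δ ℕ.+ Δ
        size x = subst (_≤ Δ ℕ.+ Δ) (cong suc (trans (↭-length (shift s T₁ T₂))
          (trans (ℕₚ.+-comm 1 (length R)) (sym (Listₚ.length-++ R))))) length-T

    -- All deletions have the same size D, so spreading three or more pairs produces a choice of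
    -- value above D. Its head `g` lies in the span of the remaining `S` together with `e`, while
    -- `S` completed by `e` has value of size exactly D: again a ratio other than ±1.
    long-circuit : (∀ T₁ s T₂ → T ≡ T₁ ++ s ∷ T₂ → ∣ val G (f ∷ T₁ ++ T₂ ++ u) ∣ ≡ ∣ val G (T ++ u) ∣) → 2 ≤ length T → Drop
    long-circuit units T≥2 with pairs (dbl-f ∷ dbl-T)
    ... | (_ , f′) ∷ P , refl , shifts with spread-∣∣ (spreadable {U = Unit} {W = λ d → d ≡ D} {D = D} proj₁
            (λ d≡D d≡0 → T≢0 (ℤₚ.∣i∣≡0⇒i≡0 (trans (sym d≡D) (cong ∣_∣ d≡0))))
            (λ {a} {b} {d} {t} → weigh {a} {b} {d} {t}) ((f , f′) ∷ P) F shifts units′)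
      where
      D = ∣ val G (T ++ u) ∣
      weigh : ∀ {a b d t} → Unit a b → ∣ d ∣ ≡ D → a * t ≡ b * d → D ≤ ∣ t ∣
      weigh {a} {b} {d} {t} (a≢0 , a≡b) d≡D eq = ℕₚ.≤-reflexive (trans (sym d≡D)
        (sym (ℕₚ.*-cancelˡ-≡ _ _ (∣ a ∣) {{ℕ.≢-nonZero (λ p → a≢0 (ℤₚ.∣i∣≡0⇒i≡0 p))}} (begin
          ∣ a ∣ ℕ.* ∣ t ∣  ≡⟨ ℤₚ.abs-* a t ⟨
          ∣ a * t ∣        ≡⟨ cong ∣_∣ eq ⟩
          ∣ b * d ∣        ≡⟨ ℤₚ.abs-* b d ⟩
          ∣ b ∣ ℕ.* ∣ d ∣  ≡⟨ cong (ℕ._* ∣ d ∣) a≡b ⟨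
          ∣ a ∣ ℕ.* ∣ d ∣  ∎))))
        where open ≡-Reasoning
      units′ : ∀ L₁ s L₂ → f ∷ T ≡ L₁ ++ s ∷ L₂ → ∣ val G (L₁ ++ L₂ ++ u) ∣ ≡ D
      units′ []       s L₂ refl = refl
      units′ (_ ∷ L₁) s L₂ eq with Listₚ.∷-injective eq
      ... | refl , eq′ = units L₁ s L₂ eq′
    ... | hi , lo , chi , clo , bound = choose (large-summand (ℕₚ.n≢0⇒n>0 λ p → T≢0 (ℤₚ.∣i∣≡0⇒i≡0 p))
            (s≤s (subst (2 ≤_) (Listₚ.length-map proj₁ P) T≥2)) bound)
      where
      shifts~ : All (λ p → G ⊢ proj₁ p ~ proj₂ p) ((f , f′) ∷ P)
      shifts~ = All.map (shift⇒~ F proj₁) shifts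

      drop : ∀ {c} → Choice ((f , f′) ∷ P) c → ∣ val G (T ++ u) ∣ < ∣ val F (c ++ u) ∣ → Drop
      drop {g ∷ S} ch@(_ ∷ chS) D< = drop-≢ {S ++ [ g ]} {S ++ [ e ]} {u = u}
        (λ v → subst₂ (λ l l′ → val F (S ++ e ∷ u) * val F l ≡ val F (S ++ g ∷ u) * val F l′)
           (sym (Listₚ.++-assoc S [ g ] v)) (sym (Listₚ.++-assoc S [ e ] v))
           (trans (cong₂ _*_ (sym (val-⫽ F S (e ∷ u))) (sym (val-⫽ F S (g ∷ v))))
             (trans (cramer (F ⫽ S) null-g u v) (cong₂ _*_ (val-⫽ F S (g ∷ u)) (val-⫽ F S (e ∷ v))))))
        Se≢0 Sg≢0 (subst (λ l → val F l ≢ 0ℤ) (sym (Listₚ.++-assoc S [ e ] u)) Se≢0) (size g) (size e)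
        (λ p → ℕₚ.<⇒≢ D< (trans (sym Se≡D) (trans (sym p) Sg≡)))
        where
        Se≡D : ∣ val F (S ++ e ∷ u) ∣ ≡ ∣ val G (T ++ u) ∣
        Se≡D = trans (∣val∣-↭ F (shift e S u)) (cong ∣_∣ (choice-val G (All.tail shifts~) chS u))
        Sg≡ : ∣ val F (S ++ g ∷ u) ∣ ≡ ∣ val F (g ∷ S ++ u) ∣
        Sg≡ = ∣val∣-↭ F (shift g S u)
        Se≢0 : val F (S ++ e ∷ u) ≢ 0ℤ
        Se≢0 = ∣∣-≢0 (sym Se≡D) T≢0
        Sg≢0 : val F (S ++ g ∷ u) ≢ 0ℤ
        Sg≢0 p = ℕₚ.n≮0 (subst (_ <_) (trans (sym Sg≡) (cong ∣_∣ p)) D<)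
        null-g : Null (F ⫽ S / e) g
        null-g v = trans (val-⫽ F S (e ∷ g ∷ v)) (val≡0-↭ F
          (↭-sym (↭-trans (shift e S (g ∷ v)) (↭p e (shift g S v))))
          (trans (choice-val G shifts~ ch v) (val≡0-↭ G (shift f T v) (⫽-null G T null v))))
        size : ∀ x → length (S ++ [ x ]) ≤ Δ ℕ.+ Δ
        size x = ℕₚ.≤-trans (ℕₚ.≤-reflexive (trans (Listₚ.length-++ S) (trans (ℕₚ.+-comm (length S) 1)
          (cong suc (trans (sym (Pointwise-length chS)) (sym (Listₚ.length-map proj₁ P))))))) length-T

      choose : _ ⊎ _ → Drop
      choose (inj₁ big) = drop chi big
      choose (inj₂ big) = drop clo big

    -- An empty `T` would make `f` null. A single `s` with unit coefficient would make `f` equal to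
    -- ±s modulo `e`, which `apart` excludes. All longer circuits have at least three elements.
    no-circuit : Drop
    no-circuit with unit-coefficients
    ... | inj₁ drop  = drop
    ... | inj₂ units = by-length T refl
      where
      by-length : ∀ T′ → T ≡ T′ → Drop
      by-length []           refl = ⊥-elim (proj₂ f≢0 (null (proj₁ f≢0)))
      by-length (s ∷ [])     refl = ⊥-elim (helper (∣i∣≡∣j∣⇒i≡±j _ _ (units [] s [] refl)))
        where
        scaled : ∀ {c} → val G (f ∷ u) ≡ c * val G (s ∷ u) → Multiple c G f s
        scaled {c} p v = *-cancelˡ-≢0 T≢0 (trans (cramer G null u v)
          (trans (cong (_* val G (s ∷ v)) p) (rearrange c (val G (s ∷ u)) (val G (s ∷ v)))))
          where
          rearrange : ∀ c a b → c * a * b ≡ a * (c * b)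
          rearrange = solve-∀
        helper : val G (f ∷ u) ≡ val G (s ∷ u) ⊎ val G (f ∷ u) ≡ - val G (s ∷ u) → ⊥
        helper (inj₁ p) = proj₁ (All.head apart) λ v → trans (scaled {1ℤ} (trans p (sym (ℤₚ.*-identityˡ _))) v) (ℤₚ.*-identityˡ _)
        helper (inj₂ p) = proj₂ (All.head apart) (scaled { -1ℤ } (trans p (sym (ℤₚ.-1*i≡-i _))))
      by-length (_ ∷ _ ∷ _)  refl = long-circuit units (s≤s (s≤s z≤n))

-- Lost rows are independent up to sign

module Independence {E : Set} (F : Form E) {e z} (Δ′ : ℕ) (bnd : Bounded F (suc Δ′)) (e≢0 : val F (e ∷ z) ≢ 0ℤ)
                    {q} (rk : Ranked F (suc q)) where
  open Unimodular F Δ′ bnd e≢0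

  Apart : List E → E → Set
  Apart S f = All (λ s → ¬ G ⊢ f ~ s × ¬ Anti f s) S

  anti? : ∀ s f → Dec (Anti f s)
  anti? s f with multiple? -1ℤ G e≢0 f s
  ... | inj₁ p       = yes p
  ... | inj₂ (u , ≢) = no λ p → ≢ (p u)

  -- Moving `f` from `l` to `S` removes it and at most one negative of it from `l`, so the left-hand
  -- side never decreases. In the end `S` extends to a basis of `G`, which has rank `q`. The
  -- argument `n` serves termination.
  count-up-to-sign : ∀ n l S → length l ≤ n → (∃ λ u → val G (S ++ u) ≢ 0ℤ) → All UnitDoubled S →
    AllPairs (λ x y → ¬ G ⊢ x ~ y) l → All UnitDoubled l → All NonNull l → All (Apart S) l →
    Drop ⊎ length l ℕ.+ 2 ℕ.* length S ≤ 2 ℕ.* q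
  count-up-to-sign n [] S l≤n (u , S≢0) dbl-S ≁l dbl-l nn-l ap-l = inj₂ (ℕₚ.*-monoʳ-≤ 2 (begin
    length S                 ≤⟨ ℕₚ.m≤m+n (length S) (length u) ⟩
    length S ℕ.+ length u    ≡⟨ Listₚ.length-++ S ⟨
    length (S ++ u)          ≡⟨ ranked-/ F rk e _ S≢0 ⟩
    q                        ∎))
    where open ℕₚ.≤-Reasoning
  count-up-to-sign (suc n) (f ∷ l) S (s≤s l≤n) (u , S≢0) dbl-S (f≁ ∷ ≁l) (dbl-f ∷ dbl-l) (f≢0 ∷ nn-l) (ap-f ∷ ap-l)
    with null? (G ⫽ S) {u} (λ p → S≢0 (trans (sym (val-⫽ G S u)) p)) f
  ... | inj₁ null = inj₁ dependent
    where
    dependent : Drop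
    dependent with minimal-circuit S G f S≢0 null
    ... | T , T⊆S , (v , T≢0) , nullT , minimal =
      no-circuit (All-resp-⊆ T⊆S dbl-S) dbl-f f≢0 (All-resp-⊆ T⊆S ap-f) T≢0 nullT minimal
  ... | inj₂ (v , f∉S) = Sum.map₂ extend
        (count-up-to-sign n l′ (f ∷ S) (ℕₚ.≤-trans (Listₚ.length-filter _ l) l≤n)
          (v , val≢0-↭ G (shift f S v) (subst (_≢ 0ℤ) (val-⫽ G S (f ∷ v)) f∉S)) (dbl-f ∷ dbl-S)
          (AllPairsₚ.filter⁺ _ ≁l) (Allₚ.filter⁺ _ dbl-l) (Allₚ.filter⁺ _ nn-l)
          (All.zipWith (λ { ((f≁h , ¬anti) , ap) → ((λ h~f → f≁h (~-sym {F = G} h~f)) , ¬anti) ∷ ap })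
            (All.zip (Allₚ.filter⁺ _ f≁ , Allₚ.all-filter (¬? ∘ anti? f) l) , Allₚ.filter⁺ _ ap-l)))
    where
    l′ = filter (¬? ∘ anti? f) l
    extend : length l′ ℕ.+ 2 ℕ.* suc (length S) ≤ 2 ℕ.* q → suc (length l) ℕ.+ 2 ℕ.* length S ≤ 2 ℕ.* q
    extend bound = begin
      suc (length l) ℕ.+ 2 ℕ.* length S
        ≡⟨ cong (λ t → suc t ℕ.+ 2 ℕ.* length S) (length-filter (anti? f) l) ⟩
      suc (length (filter (anti? f) l) ℕ.+ length l′) ℕ.+ 2 ℕ.* length S
        ≤⟨ ℕₚ.+-monoˡ-≤ (2 ℕ.* length S) (s≤s (ℕₚ.+-monoˡ-≤ (length l′)
             (atMost-one (λ p p′ u → trans (p u) (sym (p′ u))) (filter (anti? f) l)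
                (AllPairsₚ.filter⁺ _ ≁l) (Allₚ.all-filter (anti? f) l)))) ⟩
      2 ℕ.+ length l′ ℕ.+ 2 ℕ.* length S            ≡⟨ rearrange (length l′) (length S) ⟩
      length l′ ℕ.+ 2 ℕ.* suc (length S)            ≤⟨ bound ⟩
      2 ℕ.* q                                       ∎
      where
      open ℕₚ.≤-Reasoning
      rearrange : ∀ a b → 2 ℕ.+ a ℕ.+ 2 ℕ.* b ≡ a ℕ.+ 2 ℕ.* suc b
      rearrange = ℕsolve-∀

  module _ {l} (sp : Split (G ⊢_~_) (λ x y → ¬ F ⊢ x ~ y) l) where
    open Split sp

    Overlapping : E → Set
    Overlapping f = NonNull f × Any (G ⊢ f ~_) first × All (λ x → ¬ F ⊢ f ~ x) first

    overlap-unit : ∀ {f} → Overlapping f → Drop ⊎ UnitDoubled f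
    overlap-unit (f≢0 , rel , cross) with All.lookupAny cross rel
    ... | f≁x , f~x = unit-shift f~x f≁x f≢0

    overlap-collision : ∀ {f g} → Overlapping f → Overlapping g → ¬ F ⊢ f ~ g → G ⊢ f ~ g → Drop
    overlap-collision (f≢0 , rel-f , cross-f) (g≢0 , _ , cross-g) f≁g f~g with All.lookupAny (All.zip (cross-f , cross-g)) rel-f
    ... | (f≁x , g≁x) , f~x = collision f~x f≁x g≁x f≢0 g≢0 f≁g f~g

    second-count : Drop ⊎ length second ≤ 2 ℕ.* q ℕ.+ span-count Δ
    second-count = conclude (traverse overlap-unit overlaps)
                            (distinct-or (~? G e≢0) overlap-collision overlaps (AllPairsₚ.filter⁺ _ second-S))
      where
      nn? : ∀ x → Dec (NonNull x)
      nn? = nonnull? G e≢0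
      l₃ = filter nn? second
      overlaps : All Overlapping l₃
      overlaps = All.zip (Allₚ.all-filter nn? second , Allₚ.filter⁺ _ (All.zip (related , cross-S)))
      conclude : Drop ⊎ All UnitDoubled l₃ → Drop ⊎ AllPairs (λ x y → ¬ G ⊢ x ~ y) l₃ → Drop ⊎ length second ≤ 2 ℕ.* q ℕ.+ span-count Δ
      conclude (inj₁ drop) _           = inj₁ drop
      conclude (inj₂ _)    (inj₁ drop) = inj₁ drop
      conclude (inj₂ dbl)  (inj₂ ≁l₃)  = Sum.map₂ bound
        (count-up-to-sign (length l₃) l₃ [] ℕₚ.≤-refl (z , e≢0) [] ≁l₃ dbl (Allₚ.all-filter nn? second) (All.universal (λ _ → []) l₃))
        where
        bound : length l₃ ℕ.+ 0 ≤ 2 ℕ.* q → length second ≤ 2 ℕ.* q ℕ.+ span-count Δ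
        bound l₃≤ = subst (_≤ 2 ℕ.* q ℕ.+ span-count Δ) (sym (length-filter nn? second))
          (ℕₚ.+-mono-≤ (subst (_≤ 2 ℕ.* q) (ℕₚ.+-identityʳ _) l₃≤)
            -- The null members of `second` are equal to `e` modulo `e`, so they form a single
            -- fibre.
            (atMost-fibre F bnd e≢0 e _ (AllPairsₚ.filter⁺ _ second-S)
              (All.map (λ ¬nn → null-~ {F = G} (repeat F e) (λ u → decidable-stable (_ ℤₚ.≟ _) (λ ≢0 → ¬nn (u , ≢0))))
                (Allₚ.all-filter (¬? ∘ nn?) second))))

-- Induction on Δ and on the rank

distinct-constant : ℕ → ℕ
distinct-constant zero    = 0
-- The middle term pays for contracting a dropped set of at most twice `suc Δ` elements at the
-- coarse linear rate; the last term pays for the rows that become null when `e` is contracted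
-- without a drop.
distinct-constant (suc Δ) =
  distinct-constant Δ ℕ.+ (suc Δ ℕ.+ suc Δ) ℕ.* (suc (loss (suc Δ)) ℕ.* span-count (suc Δ)) ℕ.+ span-count (suc Δ)

contraction-loss-linear : ∀ Δ q → 1 ≤ q → contraction-loss Δ q ≤ suc (loss Δ) ℕ.* span-count Δ ℕ.* q
contraction-loss-linear Δ q 1≤q = begin
  (loss Δ ℕ.* q ℕ.+ 1) ℕ.* span-count Δ    ≤⟨ ℕₚ.*-monoˡ-≤ (span-count Δ) (ℕₚ.+-monoʳ-≤ (loss Δ ℕ.* q) 1≤q) ⟩
  (loss Δ ℕ.* q ℕ.+ q) ℕ.* span-count Δ    ≡⟨ rearrange (loss Δ) q (span-count Δ) ⟩
  suc (loss Δ) ℕ.* span-count Δ ℕ.* q      ∎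
  where
  open ℕₚ.≤-Reasoning
  rearrange : ∀ a q k → (a ℕ.* q ℕ.+ q) ℕ.* k ≡ suc a ℕ.* k ℕ.* q
  rearrange = ℕsolve-∀

module _ {E : Set} where

  -- The final 1 is the null class, the only class in rank 0.
  DistinctCount : ℕ → Set
  DistinctCount Δ = ∀ q (F : Form E) → Ranked F q → Bounded F Δ → ∀ {b} → val F b ≢ 0ℤ →
                    AtMost (F ⊢_~_) (λ _ → ⊤) (q ℕ.* q ℕ.+ distinct-constant Δ ℕ.* q ℕ.+ 1)

  distinct-count-suc : ∀ Δ → DistinctCount Δ → DistinctCount (suc Δ)
  distinct-count-suc Δ smaller zero F rk bnd b≢0 =
    subst (AtMost (F ⊢_~_) _) (cong (ℕ._+ 1) (sym (ℕₚ.*-zeroʳ (distinct-constant (suc Δ)))))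
      (atMost-one λ _ _ → null-~ {F = F} null null)
    where
    null : ∀ {x} → Null F x
    null {x} u = decidable-stable (_ ℤₚ.≟ _) λ ≢0 → ℕₚ.1+n≢0 (rk (x ∷ u) ≢0)
  distinct-count-suc Δ smaller (suc q) F rk bnd {[]} b≢0 with rk [] b≢0
  ... | ()
  distinct-count-suc Δ smaller (suc q) F rk bnd {e ∷ z} e≢0 l ≁l _ = conclude (second-count sp)
    where
    open Unimodular F Δ bnd e≢0 using (G; Drop)
    open Independence F Δ bnd e≢0 rk
    sp : Split (G ⊢_~_) (λ x y → ¬ F ⊢ x ~ y) l
    sp = split (~? G e≢0) (λ n p → n (~-sym {F = F} p)) l ≁l
    open Split sp
    open ℕₚ.≤-Reasoning
    c c′ k M : ℕ
    c  = distinct-constant (suc Δ)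
    c′ = distinct-constant Δ
    k  = suc Δ ℕ.+ suc Δ
    M  = span-count (suc Δ)
    n = suc q

    dropped : Drop → length l ≤ n ℕ.* n ℕ.+ c ℕ.* n ℕ.+ 1
    dropped (A , A≤ , (u , A≢0) , bounded) = begin
      length l
        ≤⟨ atMost-⫽ (suc Δ) A F ℕₚ.≤-refl rk bnd A≢0 (smaller q′ (F ⫽ A) ranked (bounded-⫽ F A bounded)
             (λ p → A≢0 (trans (sym (val-⫽ F A u)) p))) l ≁l (All.universal (λ _ → tt) l) ⟩
      q′ ℕ.* q′ ℕ.+ c′ ℕ.* q′ ℕ.+ 1 ℕ.+ length A ℕ.* contraction-loss (suc Δ) n
        ≤⟨ ℕₚ.+-mono-≤ (ℕₚ.+-monoˡ-≤ 1 (ℕₚ.+-mono-≤ (ℕₚ.*-mono-≤ q′≤n q′≤n) (ℕₚ.*-monoʳ-≤ c′ q′≤n)))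
             (ℕₚ.*-mono-≤ A≤ (contraction-loss-linear (suc Δ) n (s≤s z≤n))) ⟩
      n ℕ.* n ℕ.+ c′ ℕ.* n ℕ.+ 1 ℕ.+ k ℕ.* (suc (loss (suc Δ)) ℕ.* M ℕ.* n)
        ≤⟨ ℕₚ.m≤m+n _ (M ℕ.* n) ⟩
      n ℕ.* n ℕ.+ c′ ℕ.* n ℕ.+ 1 ℕ.+ k ℕ.* (suc (loss (suc Δ)) ℕ.* M ℕ.* n) ℕ.+ M ℕ.* n
        ≡⟨ rearrange n c′ k (loss (suc Δ)) M ⟩
      n ℕ.* n ℕ.+ c ℕ.* n ℕ.+ 1 ∎
      where
      q′ = n ℕ.∸ length A
      q′≤n : q′ ≤ n
      q′≤n = ℕₚ.m∸n≤m n (length A)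
      ranked : Ranked (F ⫽ A) q′
      ranked v v≢0 = trans (sym (ℕₚ.m+n∸m≡n (length A) (length v)))
        (cong (ℕ._∸ length A) (trans (sym (Listₚ.length-++ A)) (rk (A ++ v) (subst (_≢ 0ℤ) (val-⫽ F A v) v≢0))))
      rearrange : ∀ n c k a M → n ℕ.* n ℕ.+ c ℕ.* n ℕ.+ 1 ℕ.+ k ℕ.* (suc a ℕ.* M ℕ.* n) ℕ.+ M ℕ.* n
                              ≡ n ℕ.* n ℕ.+ (c ℕ.+ k ℕ.* (suc a ℕ.* M) ℕ.+ M) ℕ.* n ℕ.+ 1
      rearrange = ℕsolve-∀

    conclude : Drop ⊎ length second ≤ 2 ℕ.* q ℕ.+ M → length l ≤ n ℕ.* n ℕ.+ c ℕ.* n ℕ.+ 1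
    conclude (inj₁ drop)    = dropped drop
    conclude (inj₂ second≤) = begin
      length l                                                    ≡⟨ length-split ⟩
      length first ℕ.+ length second
        ≤⟨ ℕₚ.+-mono-≤ (distinct-count-suc Δ smaller q (F / e) (ranked-/ F rk e) (bounded-/ F bnd e) e≢0 first first-distinct
             (All.universal (λ _ → tt) first)) second≤ ⟩
      q ℕ.* q ℕ.+ c ℕ.* q ℕ.+ 1 ℕ.+ (2 ℕ.* q ℕ.+ M)
        ≤⟨ ℕₚ.+-monoʳ-≤ (q ℕ.* q ℕ.+ c ℕ.* q ℕ.+ 1)
             (ℕₚ.+-monoʳ-≤ (2 ℕ.* q) (ℕₚ.≤-trans (ℕₚ.m≤n+m M (c′ ℕ.+ k ℕ.* (suc (loss (suc Δ)) ℕ.* M))) (ℕₚ.n≤1+n c))) ⟩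
      -- The leading coefficient 1 arises here: 2q and the 1 in `suc c` complete q² to the next
      -- square, and the remaining `c` raises the linear term.
      q ℕ.* q ℕ.+ c ℕ.* q ℕ.+ 1 ℕ.+ (2 ℕ.* q ℕ.+ suc c)         ≡⟨ rearrange q c ⟩
      n ℕ.* n ℕ.+ c ℕ.* n ℕ.+ 1                                  ∎
      where
      rearrange : ∀ q c → q ℕ.* q ℕ.+ c ℕ.* q ℕ.+ 1 ℕ.+ (2 ℕ.* q ℕ.+ suc c) ≡ suc q ℕ.* suc q ℕ.+ c ℕ.* suc q ℕ.+ 1
      rearrange = ℕsolve-∀

  distinct-count : ∀ Δ → DistinctCount Δ
  distinct-count zero    q F rk bnd {b} b≢0 = ⊥-elim (b≢0 (ℤₚ.∣i∣≡0⇒i≡0 (ℕₚ.n≤0⇒n≡0 (bnd b))))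
  distinct-count (suc Δ) = distinct-count-suc Δ (distinct-count Δ)

-- Determinants

alternatingSum : (p : ℕ) → (Fin p → ℤ) → ℤ
alternatingSum zero t = + 0
alternatingSum (suc p) t = t zero + - alternatingSum p (λ j → t (suc j))

alternatingSum-unique : (d : ∀ k → Matrix (suc k) (suc k) → (Fin k → ℤ) → ℤ) → (∀ M t → d 0 M t ≡ + 0) →
  (∀ p M t → d (suc p) M t ≡ t zero + - d p (λ i j → M (suc i) (suc j)) (λ j → t (suc j))) →
  ∀ p M t → d p M t ≡ alternatingSum p t
alternatingSum-unique f a b zero    M t = a M t
alternatingSum-unique f a b (suc p) M t = trans (b p M t) (cong (λ x → t zero + - x) (alternatingSum-unique f a b p _ _))

rowTerm : ∀ {k} → Matrix (suc k) (suc k) → Fin (suc k) → ℤ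
rowTerm M j = M zero j * det (λ i l → M (suc i) (punchIn j l))

-- The local function of det has no name here, so go′ is left to unification. It ignores
-- its matrix argument, hence any matrix of the right size may be supplied in the recursion.
mutual
  go′ : ∀ k → Matrix (suc k) (suc k) → (Fin k → ℤ) → ℤ
  go′ = _

  det-suc : ∀ {k} (M : Matrix (suc k) (suc k)) → det M ≡ alternatingSum (suc k) (rowTerm M)
  det-suc {k} M with M zero zero * det (λ i l → M (suc i) (suc l))
                   | (λ j → M zero (suc j) * det (λ i l → M (suc i) (punchIn (suc j) l)))
  ... | x | t = cong (λ y → x + - y) (go-alt k M t)

  go-alt : ∀ k M t → go′ k M t ≡ alternatingSum k t
  go-alt k M t = alternatingSum-unique go′ (λ _ _ → refl) (λ _ _ _ → refl) k M t

alternatingSum-cong : ∀ k {s t : Fin k → ℤ} → (∀ j → s j ≡ t j) → alternatingSum k s ≡ alternatingSum k t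
alternatingSum-cong zero    eq = refl
alternatingSum-cong (suc k) eq = cong₂ (λ a b → a + - b) (eq zero) (alternatingSum-cong k (λ j → eq (suc j)))

ΣFin-cong : ∀ k {s t : Fin k → ℤ} → (∀ i → s i ≡ t i) → ΣFin k s ≡ ΣFin k t
ΣFin-cong zero    eq = refl
ΣFin-cong (suc k) eq = cong₂ _+_ (eq zero) (ΣFin-cong k (λ i → eq (suc i)))

ΣFin-zero : ∀ k → ΣFin k (λ _ → 0ℤ) ≡ 0ℤ
ΣFin-zero zero    = refl
ΣFin-zero (suc k) = trans (ℤₚ.+-identityˡ _) (ΣFin-zero k)

ΣFin-linear : ∀ k c (s t : Fin k → ℤ) → ΣFin k (λ i → c * s i - t i) ≡ c * ΣFin k s - ΣFin k t
ΣFin-linear zero    c s t = sym (cong (_- 0ℤ) (ℤₚ.*-zeroʳ c))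
ΣFin-linear (suc k) c s t = trans (cong (λ x → c * s zero - t zero + x) (ΣFin-linear k c (s ∘ suc) (t ∘ suc)))
  (rearrange c (s zero) (t zero) (ΣFin k (s ∘ suc)) (ΣFin k (t ∘ suc)))
  where
  rearrange : ∀ c a b x y → c * a - b + (c * x - y) ≡ c * (a + x) - (b + y)
  rearrange = solve-∀

ΣFin-neg : ∀ k (s : Fin k → ℤ) → ΣFin k (λ i → - s i) ≡ - ΣFin k s
ΣFin-neg zero    s = refl
ΣFin-neg (suc k) s = trans (cong (λ t → - s zero + t) (ΣFin-neg k (s ∘ suc))) (sym (ℤₚ.neg-distrib-+ (s zero) _))

-- Exterior products of functionals and their Plücker identity

module _ {E : Set} where

  -- The exterior product φ ∧ f.
  expand : (E → ℤ) → (List E → ℤ) → List E → ℤ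
  expand φ f []       = 0ℤ
  expand φ f (r ∷ rs) = φ r * f rs - expand φ (λ l → f (r ∷ l)) rs

  -- The exterior product of the functionals, expanded column by column, whereas `det` expands by
  -- rows; `volume-row` reconciles the two. With the rows in a list it is defined, as zero, in the
  -- wrong lengths too.
  volume : ∀ k → (Fin k → E → ℤ) → List E → ℤ
  volume zero    φ []      = 1ℤ
  volume zero    φ (_ ∷ _) = 0ℤ
  volume (suc k) φ         = expand (φ zero) (volume k (φ ∘ suc))

  Alternating : (List E → ℤ) → Set
  Alternating f = ∀ p x y s → f (p ++ x ∷ y ∷ s) ≡ - f (p ++ y ∷ x ∷ s)

  expand-cong : ∀ φ {f g : List E → ℤ} → (∀ l → f l ≡ g l) → ∀ l → expand φ f l ≡ expand φ g l
  expand-cong φ eq []       = refl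
  expand-cong φ eq (r ∷ rs) = cong₂ (λ a b → φ r * a - b) (eq rs) (expand-cong φ (λ l → eq (r ∷ l)) rs)

  expand-linear : ∀ φ c (f g : List E → ℤ) l → expand φ (λ l → c * f l - g l) l ≡ c * expand φ f l - expand φ g l
  expand-linear φ c f g []       = sym (cong (_- 0ℤ) (ℤₚ.*-zeroʳ c))
  expand-linear φ c f g (r ∷ rs) = trans
    (cong (λ x → φ r * (c * f rs - g rs) - x) (expand-linear φ c (λ l → f (r ∷ l)) (λ l → g (r ∷ l)) rs))
    (rearrange (φ r) c (f rs) (g rs) _ _)
    where
    rearrange : ∀ p c a b x y → p * (c * a - b) - (c * x - y) ≡ c * (p * a - x) - (p * b - y)
    rearrange = solve-∀

  expand-zero : ∀ φ {f : List E → ℤ} → (∀ l → f l ≡ 0ℤ) → ∀ l → expand φ f l ≡ 0ℤ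
  expand-zero φ f≡0 []       = refl
  expand-zero φ f≡0 (r ∷ rs) = cong₂ _-_ (trans (cong (φ r *_) (f≡0 rs)) (ℤₚ.*-zeroʳ (φ r))) (expand-zero φ (λ l → f≡0 (r ∷ l)) rs)

  expand-neg : ∀ φ {f g : List E → ℤ} → (∀ l → f l ≡ - g l) → ∀ l → expand φ f l ≡ - expand φ g l
  expand-neg φ f≡-g []       = refl
  expand-neg φ {f} {g} f≡-g (r ∷ rs) = trans (cong₂ (λ a b → φ r * a - b) (f≡-g rs) (expand-neg φ (λ l → f≡-g (r ∷ l)) rs))
    (rearrange (φ r) (g rs) _)
    where
    rearrange : ∀ p a x → p * - a - - x ≡ - (p * a - x)
    rearrange = solve-∀

  expand-alternating : ∀ φ {f : List E → ℤ} → Alternating f → Alternating (expand φ f)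
  expand-alternating φ {f} alt-f [] x y s = trans
    (cong (λ t → φ x * f (y ∷ s) - (φ y * f (x ∷ s) - t)) (expand-neg φ (alt-f [] x y) s))
    (rearrange (φ x * f (y ∷ s)) (φ y * f (x ∷ s)) _)
    where
    rearrange : ∀ a b e → a - (b - - e) ≡ - (b - (a - e))
    rearrange = solve-∀
  expand-alternating φ {f} alt-f (a ∷ p) x y s = trans
    (cong₂ (λ t t′ → φ a * t - t′) (alt-f p x y s) (expand-alternating φ (λ p′ → alt-f (a ∷ p′)) p x y s))
    (rearrange (φ a) (f (p ++ y ∷ x ∷ s)) _)
    where
    rearrange : ∀ p a x → p * - a - - x ≡ - (p * a - x)
    rearrange = solve-∀

  volume-alternating : ∀ k φ → Alternating (volume k φ)
  volume-alternating zero    φ []      x y s = refl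
  volume-alternating zero    φ (_ ∷ _) x y s = refl
  volume-alternating (suc k) φ = expand-alternating (φ zero) (volume-alternating k (φ ∘ suc))

  expand-anticommute : ∀ φ ψ (f : List E → ℤ) l → expand φ (expand ψ f) l ≡ - expand ψ (expand φ f) l
  expand-anticommute φ ψ f []       = refl
  expand-anticommute φ ψ f (r ∷ rs) = begin
    φ r * expand ψ f rs - expand φ (λ l → ψ r * f l - expand ψ f′ l) rs
      ≡⟨ cong (λ t → φ r * expand ψ f rs - t) (expand-linear φ (ψ r) f (expand ψ f′) rs) ⟩
    φ r * expand ψ f rs - (ψ r * expand φ f rs - expand φ (expand ψ f′) rs)
      ≡⟨ cong (λ t → φ r * expand ψ f rs - (ψ r * expand φ f rs - t)) (expand-anticommute φ ψ f′ rs) ⟩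
    φ r * expand ψ f rs - (ψ r * expand φ f rs - - expand ψ (expand φ f′) rs)
      ≡⟨ rearrange (φ r * expand ψ f rs) (ψ r * expand φ f rs) (expand ψ (expand φ f′) rs) ⟩
    - (ψ r * expand φ f rs - (φ r * expand ψ f rs - expand ψ (expand φ f′) rs))
      ≡⟨ cong (λ t → - (ψ r * expand φ f rs - t)) (expand-linear ψ (φ r) f (expand φ f′) rs) ⟨
    - (ψ r * expand φ f rs - expand ψ (λ l → φ r * f l - expand φ f′ l) rs) ∎
    where
    open ≡-Reasoning
    f′ : List E → ℤ
    f′ l = f (r ∷ l)
    rearrange : ∀ a b e → a - (b - - e) ≡ - (b - (a - e))
    rearrange = solve-∀

  -- Anticommuting brings φ j next to its second occurrence, where swapping the two equal factors
  -- changes the sign.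
  expand-volume : ∀ k φ j l → expand (φ j) (volume k φ) l ≡ 0ℤ
  expand-volume (suc k) φ zero    l = i≡-i⇒i≡0 _ (expand-anticommute (φ zero) (φ zero) (volume k (φ ∘ suc)) l)
  expand-volume (suc k) φ (suc j) l = trans (expand-anticommute (φ (suc j)) (φ zero) (volume k (φ ∘ suc)) l)
    (cong -_ (expand-zero (φ zero) (expand-volume k (φ ∘ suc) j) l))

  -- As a function of one row, the volume is a linear combination of the functionals φ j.
  module _ (Q : (E → ℤ) → Set) (Q-cong : ∀ {g h} → (∀ w → g w ≡ h w) → Q g → Q h) (Q-zero : Q (λ _ → 0ℤ))
           (Q-linear : ∀ c {g h} → Q g → Q h → Q (λ w → c * g w - h w)) where

    expand-closed : ∀ φ (h : E → List E → ℤ) → (∀ l → Q (λ w → h w l)) → ∀ u → Q (λ w → expand φ (h w) u)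
    expand-closed φ h Qh []       = Q-zero
    expand-closed φ h Qh (r ∷ rs) = Q-linear (φ r) (Qh rs) (expand-closed φ (λ w l → h w (r ∷ l)) (λ l → Qh (r ∷ l)) rs)

    volume-closed : ∀ k φ → (∀ j → Q (φ j)) → ∀ u → Q (λ w → volume k φ (w ∷ u))
    volume-closed zero    φ Qφ u = Q-zero
    volume-closed (suc k) φ Qφ u = Q-cong
      (λ w → cong (_- expand (φ zero) (λ l → volume k (φ ∘ suc) (w ∷ l)) u) (ℤₚ.*-comm (volume k (φ ∘ suc) u) (φ zero w)))
      (Q-linear (volume k (φ ∘ suc) u) (Qφ zero)
        (expand-closed (φ zero) (λ w l → volume k (φ ∘ suc) (w ∷ l)) (volume-closed k (φ ∘ suc) (Qφ ∘ suc)) u))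

  exchange-cong : ∀ (f : List E → ℤ) {g h : E → ℤ} → (∀ x → g x ≡ h x) → ∀ z w → exchange f g z w ≡ exchange f h z w
  exchange-cong f eq []       w = refl
  exchange-cong f eq (z ∷ zs) w = cong₂ (λ a b → f (w ∷ zs) * a + b) (eq z) (exchange-cong (f ∘ (z ∷_)) eq zs w)

  exchange-linear : ∀ (f : List E → ℤ) c (g h : E → ℤ) z w →
    exchange f (λ x → c * g x - h x) z w ≡ c * exchange f g z w - exchange f h z w
  exchange-linear f c g h []       w = sym (cong (_- 0ℤ) (ℤₚ.*-zeroʳ c))
  exchange-linear f c g h (z ∷ zs) w = trans
    (cong (λ t → f (w ∷ zs) * (c * g z - h z) + t) (exchange-linear (f ∘ (z ∷_)) c g h zs w))
    (rearrange (f (w ∷ zs)) c (g z) (h z) _ _)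
    where
    rearrange : ∀ p c a b x y → p * (c * a - b) + (c * x - y) ≡ c * (p * a + x) - (p * b + y)
    rearrange = solve-∀

  exchange-zero : ∀ (f : List E → ℤ) z w → exchange f (λ _ → 0ℤ) z w ≡ 0ℤ
  exchange-zero f []       w = refl
  exchange-zero f (z ∷ zs) w = cong₂ _+_ (ℤₚ.*-zeroʳ (f (w ∷ zs))) (exchange-zero (f ∘ (z ∷_)) zs w)

  expand-exchange : ∀ φ {f : List E → ℤ} → Alternating f → ∀ z w → expand φ (λ l → f (w ∷ l)) z ≡ exchange f φ z w
  expand-exchange φ alt-f []       w = refl
  expand-exchange φ {f} alt-f (z ∷ zs) w = begin
    φ z * f (w ∷ zs) - expand φ (λ l → f (w ∷ z ∷ l)) zs
      ≡⟨ cong (λ t → φ z * f (w ∷ zs) - t) (expand-neg φ (alt-f [] w z) zs) ⟩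
    φ z * f (w ∷ zs) - - expand φ (λ l → f (z ∷ w ∷ l)) zs
      ≡⟨ cong₂ _+_ (ℤₚ.*-comm (φ z) _) (ℤₚ.neg-involutive _) ⟩
    f (w ∷ zs) * φ z + expand φ (λ l → f (z ∷ w ∷ l)) zs
      ≡⟨ cong (λ t → f (w ∷ zs) * φ z + t) (expand-exchange φ (λ p → alt-f (z ∷ p)) zs w) ⟩
    exchange f φ (z ∷ zs) w ∎
    where open ≡-Reasoning

  -- With `z` fixed, the identity is linear in the functional that sends w to the volume of `w ∷ u`,
  -- a combination of the φ j. For φ j itself it says that φ j ∧ volume vanishes on `w ∷ z`.
  volume-plücker : ∀ k φ z w u → volume k φ z * volume k φ (w ∷ u) ≡ exchange (volume k φ) (λ x → volume k φ (x ∷ u)) z w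
  volume-plücker k φ z w u = volume-closed Q Q-cong Q-zero Q-linear k φ Qφ u w
    where
    V = volume k φ
    Q : (E → ℤ) → Set
    Q g = ∀ w → V z * g w ≡ exchange V g z w
    Q-cong : ∀ {g h} → (∀ w → g w ≡ h w) → Q g → Q h
    Q-cong eq q w = trans (cong (V z *_) (sym (eq w))) (trans (q w) (exchange-cong V eq z w))
    Q-zero : Q (λ _ → 0ℤ)
    Q-zero w = trans (ℤₚ.*-zeroʳ (V z)) (sym (exchange-zero V z w))
    Q-linear : ∀ c {g h} → Q g → Q h → Q (λ w → c * g w - h w)
    Q-linear c {g} {h} qg qh w = trans (distribute (V z) c (g w) (h w))
      (trans (cong₂ (λ a b → c * a - b) (qg w) (qh w)) (sym (exchange-linear V c g h z w)))
      where
      distribute : ∀ v c a b → v * (c * a - b) ≡ c * (v * a) - v * b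
      distribute = solve-∀
    Qφ : ∀ j → Q (φ j)
    Qφ j w = trans (ℤₚ.*-comm (V z) (φ j w)) (trans (ℤₚ.i-j≡0⇒i≡j _ _ (expand-volume k φ j (w ∷ z)))
      (expand-exchange (φ j) (volume-alternating k φ) z w))

  volume-form : ∀ k → (Fin k → E → ℤ) → Form E
  volume-form k φ = record { val = volume k φ ; swap = volume-alternating k φ ; plücker = volume-plücker k φ }

  expand-ranked : ∀ k φ {f : List E → ℤ} → (∀ l → f l ≢ 0ℤ → length l ≡ k) → ∀ l → expand φ f l ≢ 0ℤ → length l ≡ suc k
  expand-ranked k φ rk [] ≢0 = ⊥-elim (≢0 refl)
  expand-ranked k φ {f} rk (r ∷ rs) ≢0 with f rs ℤₚ.≟ 0ℤ
  ... | no f≢0 = cong suc (rk rs f≢0)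
  ... | yes f≡0 = cong suc (rest k rk)
    where
    f′ : List E → ℤ
    f′ l = f (r ∷ l)
    f′≢0 : expand φ f′ rs ≢ 0ℤ
    f′≢0 p = ≢0 (cong₂ _-_ (trans (cong (φ r *_) f≡0) (ℤₚ.*-zeroʳ (φ r))) p)
    rest : ∀ k → (∀ l → f l ≢ 0ℤ → length l ≡ k) → length rs ≡ k
    rest zero    rk = ⊥-elim (f′≢0 (expand-zero φ (λ l → decidable-stable (_ ℤₚ.≟ _) (λ p → ℕₚ.1+n≢0 (rk (r ∷ l) p))) rs))
    rest (suc k) rk = expand-ranked k φ (λ l p → ℕₚ.suc-injective (rk (r ∷ l) p)) rs f′≢0

  volume-ranked : ∀ k φ → Ranked (volume-form k φ) k
  volume-ranked zero    φ []      ≢0 = refl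
  volume-ranked zero    φ (_ ∷ _) ≢0 = ⊥-elim (≢0 refl)
  volume-ranked (suc k) φ = expand-ranked k (φ zero) (volume-ranked k (φ ∘ suc))

  expand-alternatingSum : ∀ φ p (c : Fin p → ℤ) (f : Fin p → List E → ℤ) l →
    expand φ (λ l → alternatingSum p (λ j → c j * f j l)) l ≡ alternatingSum p (λ j → c j * expand φ (f j) l)
  expand-alternatingSum φ zero    c f l = expand-zero φ (λ _ → refl) l
  expand-alternatingSum φ (suc p) c f l = trans (expand-linear φ (c zero) (f zero) _ l)
    (cong (λ t → c zero * expand φ (f zero) l - t) (expand-alternatingSum φ p (c ∘ suc) (f ∘ suc) l))

  volume-row : ∀ k φ r rs → volume (suc k) φ (r ∷ rs) ≡ alternatingSum (suc k) (λ j → φ j r * volume k (φ ∘ punchIn j) rs)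
  volume-row zero    φ r rs = cong (λ t → φ zero r * volume zero (φ ∘ suc) rs + - t) (expand-zero (φ zero) (λ _ → refl) rs)
  volume-row (suc k) φ r rs = cong (λ t → φ zero r * volume (suc k) (φ ∘ suc) rs + - t)
    (trans (expand-cong (φ zero) (volume-row k (φ ∘ suc) r) rs)
           (expand-alternatingSum (φ zero) (suc k) (λ j → φ (suc j) r) (λ j → volume k (φ ∘ suc ∘ punchIn j)) rs))

  det-volume : ∀ k (φ : Fin k → E → ℤ) (r : Fin k → E) → det (λ i j → φ j (r i)) ≡ volume k φ (tabulate r)
  det-volume zero    φ r = refl
  det-volume (suc k) φ r = trans (det-suc (λ i j → φ j (r i))) (trans
    (alternatingSum-cong (suc k) (λ j → cong (φ j (r zero) *_) (det-volume k (φ ∘ punchIn j) (r ∘ suc))))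
    (sym (volume-row k φ (r zero) (tabulate (r ∘ suc)))))

  coefficient : ∀ {k} → (List E → ℤ) → (Fin k → E) → Fin k → ℤ
  coefficient f r zero    = f (tabulate (r ∘ suc))
  coefficient f r (suc i) = - coefficient (λ l → f (r zero ∷ l)) (r ∘ suc) i

  expand-tabulate : ∀ k φ f (r : Fin k → E) → expand φ f (tabulate r) ≡ ΣFin k (λ i → coefficient f r i * φ (r i))
  expand-tabulate zero    φ f r = refl
  expand-tabulate (suc k) φ f r = cong₂ _+_ (ℤₚ.*-comm (φ (r zero)) _) (begin
    - expand φ f′ (tabulate (r ∘ suc))                                       ≡⟨ cong -_ (expand-tabulate k φ f′ (r ∘ suc)) ⟩
    - ΣFin k (λ i → coefficient f′ (r ∘ suc) i * φ (r (suc i)))              ≡⟨ ΣFin-neg k _ ⟨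
    ΣFin k (λ i → - (coefficient f′ (r ∘ suc) i * φ (r (suc i))))
      ≡⟨ ΣFin-cong k (λ i → ℤₚ.neg-distribˡ-* (coefficient f′ (r ∘ suc) i) _) ⟩
    ΣFin k (λ i → - coefficient f′ (r ∘ suc) i * φ (r (suc i)))              ∎)
    where
    open ≡-Reasoning
    f′ : List E → ℤ
    f′ l = f (r zero ∷ l)

  repeat-∈ : ∀ (F : Form E) {x l} → x ∈ l → val F (x ∷ l) ≡ 0ℤ
  repeat-∈ F {x} x∈l with ∈-∃++ x∈l
  ... | ys , zs , refl = val≡0-↭ F (↭p x (↭-sym (shift x ys zs))) (repeat F x (ys ++ zs))

  -- Evaluated at the remaining rows, the relation keeps only its first term, all others repeating a
  -- row. Contracting the first row leaves a relation among the rest.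
  form-independent : ∀ k (F : Form E) (r : Fin k → E) (c : Fin k → ℤ) →
    (∀ u → ΣFin k (λ i → c i * val F (r i ∷ u)) ≡ 0ℤ) → val F (tabulate r) ≢ 0ℤ → ∀ i → c i ≡ 0ℤ
  form-independent (suc k) F r c rel ≢0 = λ { zero → c₀≡0 ; (suc i) → form-independent k (F / r zero) (r ∘ suc) (c ∘ suc) rel′ ≢0 i }
    where
    open ≡-Reasoning
    c₀≡0 : c zero ≡ 0ℤ
    c₀≡0 = *-cancelˡ-≢0 ≢0 (begin
      val F (tabulate r) * c zero        ≡⟨ ℤₚ.*-comm _ (c zero) ⟩
      c zero * val F (tabulate r)        ≡⟨ ℤₚ.+-identityʳ _ ⟨
      c zero * val F (tabulate r) + 0ℤ   ≡⟨ cong (λ t → c zero * val F (tabulate r) + t) (trans (sym (ΣFin-zero k)) (ΣFin-cong k (λ i → sym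
                                              (trans (cong (c (suc i) *_) (repeat-∈ F (∈-tabulate⁺ i))) (ℤₚ.*-zeroʳ (c (suc i))))))) ⟩
      ΣFin (suc k) (λ i → c i * val F (r i ∷ tabulate (r ∘ suc))) ≡⟨ rel (tabulate (r ∘ suc)) ⟩
      0ℤ                                 ≡⟨ ℤₚ.*-zeroʳ (val F (tabulate r)) ⟨
      val F (tabulate r) * 0ℤ            ∎)
    rel′ : ∀ u → ΣFin k (λ i → c (suc i) * val F (r zero ∷ r (suc i) ∷ u)) ≡ 0ℤ
    rel′ u = begin
      ΣFin k (λ i → c (suc i) * val F (r zero ∷ r (suc i) ∷ u))
        ≡⟨ ΣFin-cong k (λ i → trans (cong (c (suc i) *_) (swap F [] (r zero) (r (suc i)) u)) (sym (ℤₚ.neg-distribʳ-* (c (suc i)) _))) ⟩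
      ΣFin k (λ i → - (c (suc i) * val F (r (suc i) ∷ r zero ∷ u)))
        ≡⟨ ΣFin-neg k _ ⟩
      - ΣFin k (λ i → c (suc i) * val F (r (suc i) ∷ r zero ∷ u))
        ≡⟨ cong -_ (ℤₚ.+-identityˡ _) ⟨
      - (0ℤ + ΣFin k (λ i → c (suc i) * val F (r (suc i) ∷ r zero ∷ u)))
        ≡⟨ cong (λ t → - (t + ΣFin k (λ i → c (suc i) * val F (r (suc i) ∷ r zero ∷ u))))
             (trans (cong (c zero *_) (repeat F (r zero) u)) (ℤₚ.*-zeroʳ (c zero))) ⟨
      - (c zero * val F (r zero ∷ r zero ∷ u) + ΣFin k (λ i → c (suc i) * val F (r (suc i) ∷ r zero ∷ u)))
        ≡⟨ cong -_ (rel (r zero ∷ u)) ⟩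
      0ℤ ∎

-- From forms back to integer matrices

module _ {r n : ℕ} (A : Matrix r n) where

  columns : ∀ {k} → (Fin k → Fin n) → Fin k → Fin r → ℤ
  columns g j x = A x (g j)

  -- A relation valid in every column holds for all combinations of columns, among them the
  -- functionals that `form-independent` tests.
  minor≢0⇒independent : ∀ k (g : Fin k → Fin n) (f : Fin k → Fin r) → volume k (columns g) (tabulate f) ≢ 0ℤ → RowsIndependent A f
  minor≢0⇒independent k g f ≢0 c rel = form-independent k (volume-form k (columns g)) f c
    (volume-closed Q (λ eq q → trans (ΣFin-cong k (λ i → cong (c i *_) (sym (eq (f i))))) q)
      (trans (ΣFin-cong k (λ i → ℤₚ.*-zeroʳ (c i))) (ΣFin-zero k)) Q-linear k (columns g) (λ j → rel (g j))) ≢0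
    where
    Q : (Fin r → ℤ) → Set
    Q h = ΣFin k (λ i → c i * h (f i)) ≡ 0ℤ
    Q-linear : ∀ a {g h} → Q g → Q h → Q (λ w → a * g w - h w)
    Q-linear a {g} {h} qg qh = trans (ΣFin-cong k (λ i → distribute (c i) a (g (f i)) (h (f i))))
      (trans (ΣFin-linear k a _ _) (trans (cong₂ (λ x y → a * x - y) qg qh) (cong (_- 0ℤ) (ℤₚ.*-zeroʳ a))))
      where
      distribute : ∀ v c a b → v * (c * a - b) ≡ c * (v * a) - v * b
      distribute = solve-∀

  -- The cofactors along an adjoined column do not depend on that column. If every column gave a
  -- zero minor, they would form a relation among the rows whose first coefficient is the nonzero
  -- minor of the other rows.
  independent⇒minor≢0 : ∀ k (f : Fin k → Fin r) → RowsIndependent A f → ∃ λ g → volume k (columns g) (tabulate f) ≢ 0ℤ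
  independent⇒minor≢0 zero    f ind = (λ ()) , λ ()
  independent⇒minor≢0 (suc k) f ind with independent⇒minor≢0 k (f ∘ suc) tail-independent
    where
    tail-independent : RowsIndependent A (f ∘ suc)
    tail-independent c rel i = ind (0ℤ Functional.∷ c) (λ j → trans (ℤₚ.+-identityˡ _) (rel j)) (suc i)
  ... | g , ≢0 with Finₚ.any? (λ j → ¬? (expand (λ x → A x j) (volume k (columns g)) (tabulate f) ℤₚ.≟ 0ℤ))
  ... | yes (j , ≢0′) = j Functional.∷ g , ≢0′
  ... | no none = ⊥-elim (≢0 (ind (coefficient (volume k (columns g)) f)
          (λ j → trans (sym (expand-tabulate (suc k) (λ x → A x j) (volume k (columns g)) f))
                   (decidable-stable (_ ℤₚ.≟ _) (λ p → none (j , p)))) zero))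

  volume-bounded : ∀ {Δ m} → DeltaModularOfRank Δ A m → ∀ g → Bounded (volume-form m (columns g)) Δ
  volume-bounded {Δ} {m} modular g l with volume m (columns g) l ℤₚ.≟ 0ℤ
  ... | yes p = subst (λ t → ∣ t ∣ ≤ Δ) (sym p) z≤n
  ... | no ≢0 with volume-ranked m (columns g) l ≢0
  ... | refl = subst (λ l → ∣ volume m (columns g) l ∣ ≤ Δ) (Listₚ.tabulate-lookup l)
    (subst (λ t → ∣ t ∣ ≤ Δ) (det-volume m (columns g) (lookup l)) (modular (lookup l) g))

  volume-vanishes : ∀ {m} → HasRank A m → ∀ (g : Fin (suc m) → Fin n) l → volume (suc m) (columns g) l ≡ 0ℤ
  volume-vanishes {m} (_ , maximal) g l = decidable-stable (_ ℤₚ.≟ _) λ ≢0 → helper (volume-ranked (suc m) (columns g) l ≢0) ≢0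
    where
    helper : length l ≡ suc m → volume (suc m) (columns g) l ≢ 0ℤ → ⊥
    helper eq ≢0 = impossible (length l) eq (lookup l) (Listₚ.tabulate-lookup l)
      where
      impossible : ∀ k → k ≡ suc m → (f : Fin k → Fin r) → tabulate f ≡ l → ⊥
      impossible _ refl f refl = maximal f (minor≢0⇒independent (suc m) g f ≢0)

  -- The form sees only the m chosen columns. As all minors of order m + 1 vanish, expanding along
  -- an adjoined column `j` expresses `A x j` through values of the form on lists headed by `x`.
  ~⇒row-equal : ∀ {m} → HasRank A m → ∀ (g : Fin m → Fin n) {b} → volume m (columns g) b ≢ 0ℤ →
                ∀ {x y} → volume-form m (columns g) ⊢ x ~ y → ∀ j → A x j ≡ A y j
  ~⇒row-equal {m} rank g {b} b≢0 {x} {y} x~y j = *-cancelˡ-≢0 b≢0 (trans (along x) (trans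
      (expand-cong (λ w → A w j) x~y b) (sym (along y))))
    where
    V = volume m (columns g)
    along : ∀ w → V b * A w j ≡ expand (λ w → A w j) (λ l → V (w ∷ l)) b
    along w = trans (ℤₚ.*-comm (V b) (A w j)) (ℤₚ.i-j≡0⇒i≡j _ _ (volume-vanishes rank (j Functional.∷ g) (w ∷ b)))

  row : Fin r → Vec ℤ n
  row i = Vec.tabulate (A i)

  indices : ∀ {vs} → All (λ v → ∃ λ i → v ≡ row i) vs → ∃ λ is → map row is ≡ vs
  indices []               = [] , refl
  indices ((i , refl) ∷ p) with indices p
  ... | is , refl = i ∷ is , refl

  distinctRows-bound : ∀ {m N} → HasRank A m → ∀ (g : Fin m → Fin n) {b} → volume m (columns g) b ≢ 0ℤ →
    AtMost (volume-form m (columns g) ⊢_~_) (λ _ → ⊤) N → distinctRows A ≤ N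
  distinctRows-bound {m} {N} rank g b≢0 am with indices {deduplicate (Vecₚ.≡-dec ℤₚ._≟_) (tabulate row)}
      (All.tabulate (λ v∈ → ∈-tabulate⁻ (∈-deduplicate⁻ (Vecₚ.≡-dec ℤₚ._≟_) (tabulate row) v∈)))
  ... | is , eq = subst (_≤ N) (trans (sym (Listₚ.length-map row is)) (cong length eq))
    (am is (AllPairs.map (λ row≢ x~y → row≢ (Vecₚ.tabulate-cong (~⇒row-equal rank g b≢0 x~y)))
        (AllPairsₚ.map⁻ (subst Unique (sym eq) (deduplicate-! (Vecₚ.≡-dec ℤₚ._≟_) (tabulate row)))))
      (All.universal (λ _ → tt) is))

theorem2p6 : (Δ : ℕ) → 1 ≤ Δ →
    Σ ℕ (λ c → {r n : ℕ} (A : Matrix r n) (m : ℕ) → 1 ≤ m →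
    HasRank A m → DeltaModularOfRank Δ A m →
    distinctRows A ≤ m ℕ.* m ℕ.+ c ℕ.* m)
theorem2p6 Δ _ = suc (distinct-constant Δ) , bound
  where
  bound : {r n : ℕ} (A : Matrix r n) (m : ℕ) → 1 ≤ m → HasRank A m → DeltaModularOfRank Δ A m →
          distinctRows A ≤ m ℕ.* m ℕ.+ suc (distinct-constant Δ) ℕ.* m
  bound A m 1≤m rank@((f , ind) , _) modular with independent⇒minor≢0 A m f ind
  ... | g , ≢0 = begin
    distinctRows A
      ≤⟨ distinctRows-bound A rank g ≢0 (distinct-count Δ m (volume-form m (columns A g))
           (volume-ranked m (columns A g)) (volume-bounded A modular g) ≢0) ⟩
    m ℕ.* m ℕ.+ distinct-constant Δ ℕ.* m ℕ.+ 1   ≤⟨ ℕₚ.+-monoʳ-≤ (m ℕ.* m ℕ.+ distinct-constant Δ ℕ.* m) 1≤m ⟩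
    m ℕ.* m ℕ.+ distinct-constant Δ ℕ.* m ℕ.+ m   ≡⟨ rearrange m (distinct-constant Δ) ⟩
    m ℕ.* m ℕ.+ suc (distinct-constant Δ) ℕ.* m   ∎
    where
    open ℕₚ.≤-Reasoning
    rearrange : ∀ m c → m ℕ.* m ℕ.+ c ℕ.* m ℕ.+ m ≡ m ℕ.* m ℕ.+ suc c ℕ.* m
    rearrange = ℕsolve-∀
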